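{- Let $D$ be a data structure constructed over a text $T$ of length $n$ so that, when queried for a pattern $P$ of length $m$, it returns an answer of total size $w$ in $O(m + |\mathrm{Occ}_T(P)| + w)$ time. Then there is a data structure $\hat{D}$ of size $O(|D| + w\cdot n)$ that answers the same queries for $P$ in time $O(m+w)$.
   Context: A text $T$ is a string of length $n$, and a pattern $P$ is a string of length $m \le n$. $\mathrm{Occ}_T(P)$ is the set of starting positions of occurrences of $P$ in $T$. $|D|$ denotes the size (space usage) of the data structure $D$. Sizes and answer sizes are measured in machine words in the standard word-RAM model. "Answers the same queries" means that for every pattern $P$, $\hat{D}$ returns the answer that $D$ returns for $P$. -}

module Defs where

open import Data.Bool using (Bool; _∧_; _∨_; _xor_; if_then_else_)
open import Data.Fin using (Fin; toℕ; finToFun; funToFin)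
open import Data.Fin.Properties using (2↔Bool) renaming (_≟_ to _≟-Fin_)
open import Data.List using (List; []; _∷ʳ_; length; lookup; drop; allFin; filter)
open import Data.List.Relation.Binary.Prefix.Heterogeneous using (Prefix)
open import Data.List.Relation.Binary.Prefix.Heterogeneous.Properties using (prefix?)
open import Data.Nat using (ℕ; zero; suc; _+_; _*_; _∸_; _^_; _/_; _%_; _≤_; _≡ᵇ_; _<ᵇ_)
open import Data.Nat.DivMod using (_mod_)
open import Data.Nat.Properties using (m^n≢0)
open import Data.Product using (_×_; ∃-syntax)
open import Data.Vec as Vec using (Vec; _[_]≔_; replicate)
open import Function using (Inverse)
open import Relation.Binary using (DecidableEquality)
open import Relation.Binary.PropositionalEquality using (_≡_; _≢_; cong)
open import Relation.Nullary.Decidable using (map′)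
open import Relation.Unary using (Decidable)

-- Machine words of b bits.  They form a record rather than a synonym of
-- Fin (2 ^ b) so that b can be inferred from the type.

record Word (b : ℕ) : Set where
  constructor word
  field
    index : Fin (2 ^ b)

open Word public

value : ∀ {b} → Word b → ℕ
value x = toℕ (index x)

wrap : ∀ {b} → ℕ → Word b
wrap {b} x = word (_mod_ x (2 ^ b) {{m^n≢0 2 b}})

_≟_ : ∀ {b} → DecidableEquality (Word b)
x ≟ y = map′ (cong word) (cong index) (index x ≟-Fin index y)

-- The alphabet consists of all machine words.

String : ℕ → Set
String b = List (Word b)

OccursAt : ∀ {b} (T P : String b) → Fin (length T) → Set
OccursAt T P i = Prefix _≡_ P (drop (toℕ i) T)

occursAt? : ∀ {b} (T P : String b) → Decidable (OccursAt T P)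
occursAt? T P i = prefix? _≟_ P (drop (toℕ i) T)

Occ : ∀ {b} (T P : String b) → List (Fin (length T))
Occ T P = filter (occursAt? T P) (allFin (length T))

data Op : Set where
  add sub mul div rem shl shr and or xor eq lt : Op

-- Division and remainder by zero yield zero.

divide remainder : ℕ → ℕ → ℕ
divide x zero    = 0
divide x (suc y) = x / suc y
remainder x zero    = 0
remainder x (suc y) = x % suc y

-- finToFun lists the b binary digits of an element of Fin (2 ^ b).

bitwise : ∀ {b} → (Bool → Bool → Bool) → Word b → Word b → Word b
bitwise {b} _⊙_ x y = word (funToFin λ i → from (to (digits x i) ⊙ to (digits y i)))
  where
  open Inverse 2↔Bool
  digits : Word b → Fin b → Fin 2
  digits z = finToFun {2} {b} (index z)

⟦_⟧ : Op → ∀ {b} → Word b → Word b → Word b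
⟦ add ⟧     x y = wrap (value x + value y)
⟦ sub ⟧ {b} x y = wrap (value x + (2 ^ b ∸ value y))
⟦ mul ⟧     x y = wrap (value x * value y)
⟦ div ⟧     x y = wrap (divide (value x) (value y))
⟦ rem ⟧     x y = wrap (remainder (value x) (value y))
⟦ shl ⟧     x y = wrap (value x * 2 ^ value y)
⟦ shr ⟧     x y = wrap (_/_ (value x) (2 ^ value y) {{m^n≢0 2 (value y)}})
⟦ and ⟧     x y = bitwise _∧_ x y
⟦ or ⟧      x y = bitwise _∨_ x y
⟦ xor ⟧     x y = bitwise _xor_ x y
⟦ eq ⟧      x y = wrap (if value x ≡ᵇ value y then 1 else 0)
⟦ lt ⟧      x y = wrap (if value x <ᵇ value y then 1 else 0)

-- Word-RAM programs with k registers, in structured form.  Besides its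
-- registers a query algorithm has random access to the data structure D and to
-- the pattern P, both read-only, and to a read-write working memory M; it
-- writes its answer word by word.  Programs do not depend on b, so one program
-- runs at every word size.

data Instr (k : ℕ) : Set where
  const     : (r : Fin k) (c : ℕ) → Instr k                -- r := c
  apply     : (r : Fin k) (o : Op) (x y : Fin k) → Instr k -- r := x o y
  patLen    : (r : Fin k) → Instr k                        -- r := |P|
  readPat   : (r x : Fin k) → Instr k                      -- r := P[x]
  readData  : (r x : Fin k) → Instr k                      -- r := D[x]
  readWork  : (r x : Fin k) → Instr k                      -- r := M[x]
  writeWork : (x y : Fin k) → Instr k                      -- M[x] := y
  emit      : (x : Fin k) → Instr k                        -- output x

infixr 5 _⨾_

data Cmd (k : ℕ) : Set where
  skip  : Cmd k
  instr : Instr k → Cmd k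
  _⨾_   : Cmd k → Cmd k → Cmd k
  ifnz  : (x : Fin k) (p q : Cmd k) → Cmd k
  while : (x : Fin k) (p : Cmd k) → Cmd k

record Program : Set where
  constructor program
  field
    registers : ℕ
    body      : Cmd registers

record State (b k : ℕ) : Set where
  constructor state
  field
    regs : Vec (Word b) k
    work : Vec (Word b) (2 ^ b)
    out  : List (Word b)

initial : ∀ {b k} → State b k
initial {b} {k} = state (replicate k (wrap 0)) (replicate (2 ^ b) (wrap 0)) []

reg : ∀ {b k} → State b k → Fin k → Word b
reg s x = Vec.lookup (State.regs s) x

module _ {b k : ℕ} (D : List (Word b)) (P : String b) where

  -- Reading outside D or outside P is a fault: there is no transition, hence
  -- no complete run.

  data Step : Instr k → State b k → State b k → Set where
    const     : ∀ {R M O r c} →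
                Step (const r c) (state R M O) (state (R [ r ]≔ wrap c) M O)
    apply     : ∀ {R M O r o x y} →
                Step (apply r o x y) (state R M O)
                     (state (R [ r ]≔ ⟦ o ⟧ (Vec.lookup R x) (Vec.lookup R y)) M O)
    patLen    : ∀ {R M O r} →
                Step (patLen r) (state R M O) (state (R [ r ]≔ wrap (length P)) M O)
    readPat   : ∀ {R M O r x} (i : Fin (length P)) → toℕ i ≡ value (Vec.lookup R x) →
                Step (readPat r x) (state R M O) (state (R [ r ]≔ lookup P i) M O)
    readData  : ∀ {R M O r x} (i : Fin (length D)) → toℕ i ≡ value (Vec.lookup R x) →
                Step (readData r x) (state R M O) (state (R [ r ]≔ lookup D i) M O)
    readWork  : ∀ {R M O r x} →
                Step (readWork r x) (state R M O)
                     (state (R [ r ]≔ Vec.lookup M (index (Vec.lookup R x))) M O)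
    writeWork : ∀ {R M O x y} →
                Step (writeWork x y) (state R M O)
                     (state R (M [ index (Vec.lookup R x) ]≔ Vec.lookup R y) O)
    emit      : ∀ {R M O x} →
                Step (emit x) (state R M O) (state R M (O ∷ʳ Vec.lookup R x))

  -- Exec p s t s′: started in s, p halts in s′ after exactly t time units,
  -- where every instruction and every evaluated test takes one unit.

  data Exec : Cmd k → State b k → ℕ → State b k → Set where
    skip    : ∀ {s} → Exec skip s 0 s
    instr   : ∀ {i s s′} → Step i s s′ → Exec (instr i) s 1 s′
    _⨾_     : ∀ {p q s s′ s″ t t′} →
              Exec p s t s′ → Exec q s′ t′ s″ → Exec (p ⨾ q) s (t + t′) s″
    ifnz    : ∀ {x p q s s′ t} → value (reg s x) ≢ 0 →
              Exec p s t s′ → Exec (ifnz x p q) s (suc t) s′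
    ifz     : ∀ {x p q s s′ t} → value (reg s x) ≡ 0 →
              Exec q s t s′ → Exec (ifnz x p q) s (suc t) s′
    whilenz : ∀ {x p s s′ s″ t t′} → value (reg s x) ≢ 0 →
              Exec p s t s′ → Exec (while x p) s′ t′ s″ →
              Exec (while x p) s (suc (t + t′)) s″
    whilez  : ∀ {x p s} → value (reg s x) ≡ 0 → Exec (while x p) s 1 s

Returns : ∀ {b} (Q : Program) (D : List (Word b)) (P : String b)
          (A : List (Word b)) (t : ℕ) → Set
Returns Q D P A t =
  ∃[ s ] Exec D P (Program.body Q) initial t s × State.out s ≡ A

-- A data structure is a memory image D, of size length D, together with a
-- query algorithm Q.  Every pattern of length at most n is to be answered, and
-- each query starts from fresh registers and working memory.

Answers : ∀ {b} (Q : Program) (D : List (Word b)) (n : ℕ)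
          (answer : String b → List (Word b)) (time : String b → ℕ) → Set
Answers Q D n answer time =
  ∀ P → length P ≤ n → ∃[ t ] Returns Q D P (answer P) t × t ≤ time P

{-# OPTIONS --safe #-}
module Submission where

open import Data.List using (List; length)
open import Data.Nat using (ℕ; _+_; _*_; _^_; _≤_)
open import Data.Product using (_×_; ∃-syntax)
open import Defs

open import Data.Bool using (T; true; false)
open import Data.Fin using (Fin; zero; suc; toℕ; fromℕ<; _↑ʳ_)
open import Data.Fin.Properties using (any?; toℕ<n; toℕ-fromℕ<; toℕ-injective) renaming (_≟_ to _≟-Fin_)
open import Data.List using ([]; _∷_; [_]; _∷ʳ_; _++_; upTo; applyUpTo; allFin; tabulate; map; filter; deduplicate; take; drop; lookup)
open import Data.List.Membership.Propositional using (_∈_)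
open import Data.List.Membership.Propositional.Properties using (∈-upTo⁺; ∈-upTo⁻; ∈-filter⁺; ∈-filter⁻; ∈-map⁺; ∈-allFin; ∈-deduplicate⁺)
open import Data.List.Properties using (++-assoc; ++-identityʳ; length-++; length-upTo; length-tabulate; length-map; length-take; length-drop; length-deduplicate)
open import Data.List.Relation.Binary.Prefix.Heterogeneous using (Prefix; []; _∷_; _++ᵖ_)
import Data.List.Relation.Binary.Prefix.Heterogeneous.Properties as Prefix
open import Data.List.Relation.Unary.All as All using ()
open import Data.List.Relation.Unary.Any using (here; there)
open import Data.List.Relation.Unary.Unique.DecPropositional.Properties using (deduplicate-!)
open import Data.List.Relation.Unary.Unique.Propositional using (Unique; []; _∷_)
open import Data.List.Relation.Unary.Unique.Propositional.Properties using (allFin⁺; upTo⁺)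
open import Data.Maybe using (Maybe; just; nothing; maybe)
import Data.Maybe.Properties as Maybe
open import Data.Nat using (zero; suc; pred; _∸_; _/_; _%_; _<_; _≡ᵇ_; _<ᵇ_; _≤?_; _<?_; z≤n; s≤s; NonZero; ≢-nonZero)
open import Data.Nat.DivMod hiding (_mod_; _/_; _%_)
open import Data.Nat.Divisibility
open import Data.Nat.Primality using (prime?; euclidsLemma)
open import Data.Nat.Properties hiding (_≟_; _≤?_; _<?_)
import Data.Nat.Properties as ℕ
open import Data.Nat.Tactic.RingSolver using (solve-∀)
open import Data.Product using (Σ-syntax; _,_; proj₁; proj₂)
open import Data.Sum using (_⊎_; inj₁; inj₂; [_,_]′)
open import Data.Vec as Vec using (Vec; []; _∷_)
open import Function using (_∘_; id)
open import Relation.Binary using (tri<; tri≈; tri>)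
open import Relation.Binary.PropositionalEquality hiding ([_])
open import Relation.Nullary using (Dec; yes; no; ¬_; contradiction; _×-dec_; ¬?)
open import Relation.Nullary.Decidable using (from-yes; map′)
open import Relation.Unary using (Decidable)

-- Call a pattern P heavy if it has more than |P| occurrences.  A light pattern is
-- answered by the given algorithm, in time O(|P| + w), and the answers to heavy
-- patterns are stored.  There are at most n heavy patterns: send P to the position of
-- its occurrence number |P|.  If P and P′ went to the same position, one of them, say
-- P, would be a prefix of the other; every occurrence of P′ is one of P, so at least
-- |P′| occurrences of P precede that position, whence |P′| ≤ |P| and P = P′.
--
-- Prefixes of heavy patterns are heavy, so the heavy patterns form a trie.  Its edges
-- are kept in one perfect hash table per node (Fredman, Komlós and Szemerédi) with
-- the multiply-shift functions x ↦ (a x mod 2 ^ b) / 2 ^ s, a odd; suitable multipliers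
-- exist by averaging.  A query thus descends in constant time per letter.

-- Only the size of the new structure and its query time are measured, so it is enough that good
-- multipliers exist. Multiply-shift (Dietzfelbinger, Hagerup, Katajainen and Penttonen) suits the
-- machine: a hash is one `mul` and one `shr` on words, and no prime of word size has to be found.
-- Hashing is called for because the alphabet consists of all words, so that an array of children at
-- each node would be far too large. The tables of all nodes together stay linear because a node has
-- at most one parent.
--
-- Identifying nodes with text positions bounds their number without listing the heavy patterns: the
-- image holds one record for each position, at an address computed from the position.
--
-- One obstacle shapes the program. If all answers are empty, the size bound does not pay for a
-- record per position, although one query program has to serve every case. Word 0 of the image is
-- therefore a mode flag, and the construction splits on whether `W` is zero.

private variable
  A B : Set
  b : ℕ

-- Counting by sums of indicators

∑ : List A → (A → ℕ) → ℕ
∑ []       f = 0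
∑ (x ∷ xs) f = f x + ∑ xs f

𝟙 : ∀ {P : Set} → Dec P → ℕ
𝟙 (yes _) = 1
𝟙 (no  _) = 0

𝟙≤1 : ∀ {P : Set} (P? : Dec P) → 𝟙 P? ≤ 1
𝟙≤1 (yes _) = ≤-refl
𝟙≤1 (no  _) = z≤n

𝟙-mono : ∀ {P Q : Set} (P? : Dec P) (Q? : Dec Q) → (P → Q) → 𝟙 P? ≤ 𝟙 Q?
𝟙-mono (yes p) (yes q) f = ≤-refl
𝟙-mono (yes p) (no ¬q) f = contradiction (f p) ¬q
𝟙-mono (no _)  _       f = z≤n

𝟙-yes : ∀ {P : Set} (P? : Dec P) → P → 𝟙 P? ≡ 1
𝟙-yes (yes _) p = refl
𝟙-yes (no ¬p) p = contradiction p ¬p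

𝟙-no : ∀ {P : Set} (P? : Dec P) → ¬ P → 𝟙 P? ≡ 0
𝟙-no (yes p) ¬p = contradiction p ¬p
𝟙-no (no _)  ¬p = refl

∑-mono-∈ : ∀ (xs : List A) {f g} → (∀ {x} → x ∈ xs → f x ≤ g x) → ∑ xs f ≤ ∑ xs g
∑-mono-∈ []       f≤g = z≤n
∑-mono-∈ (x ∷ xs) f≤g = +-mono-≤ (f≤g (here refl)) (∑-mono-∈ xs (f≤g ∘ there))

∑-mono : ∀ (xs : List A) {f g} → (∀ x → f x ≤ g x) → ∑ xs f ≤ ∑ xs g
∑-mono xs f≤g = ∑-mono-∈ xs (λ {x} _ → f≤g x)

∑-cong : ∀ (xs : List A) {f g} → (∀ x → f x ≡ g x) → ∑ xs f ≡ ∑ xs g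
∑-cong []       f≡g = refl
∑-cong (x ∷ xs) f≡g = cong₂ _+_ (f≡g x) (∑-cong xs f≡g)

∑-distrib-+ : ∀ (xs : List A) f g → ∑ xs (λ x → f x + g x) ≡ ∑ xs f + ∑ xs g
∑-distrib-+ []       f g = refl
∑-distrib-+ (x ∷ xs) f g = begin
  f x + g x + ∑ xs (λ x → f x + g x)  ≡⟨ cong (f x + g x +_) (∑-distrib-+ xs f g) ⟩
  f x + g x + (∑ xs f + ∑ xs g)       ≡⟨ lemma (f x) (g x) (∑ xs f) (∑ xs g) ⟩
  f x + ∑ xs f + (g x + ∑ xs g)       ∎
  where
  open ≡-Reasoning
  lemma : ∀ a b c d → a + b + (c + d) ≡ a + c + (b + d)
  lemma = solve-∀

∑-const : ∀ (xs : List A) k → ∑ xs (λ _ → k) ≡ length xs * k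
∑-const []       k = refl
∑-const (x ∷ xs) k = cong (k +_) (∑-const xs k)

∑-distribˡ-* : ∀ k (xs : List A) f → k * ∑ xs f ≡ ∑ xs (λ x → k * f x)
∑-distribˡ-* k []       f = *-zeroʳ k
∑-distribˡ-* k (x ∷ xs) f =
  trans (*-distribˡ-+ k (f x) (∑ xs f)) (cong (k * f x +_) (∑-distribˡ-* k xs f))

∑-swap : ∀ (xs : List A) (ys : List B) (f : A → B → ℕ) →
         ∑ xs (λ x → ∑ ys (λ y → f x y)) ≡ ∑ ys (λ y → ∑ xs (λ x → f x y))
∑-swap []       ys f = sym (trans (∑-const ys 0) (*-zeroʳ (length ys)))
∑-swap (x ∷ xs) ys f =
  trans (cong (∑ ys (f x) +_) (∑-swap xs ys f))
        (sym (∑-distrib-+ ys (f x) (λ y → ∑ xs (λ x → f x y))))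

∑-++ : ∀ (xs ys : List A) f → ∑ (xs ++ ys) f ≡ ∑ xs f + ∑ ys f
∑-++ []       ys f = refl
∑-++ (x ∷ xs) ys f = trans (cong (f x +_) (∑-++ xs ys f)) (sym (+-assoc (f x) (∑ xs f) (∑ ys f)))

∈⇒≤∑ : ∀ {xs : List A} {x} f → x ∈ xs → f x ≤ ∑ xs f
∈⇒≤∑ {xs = x ∷ xs} f (here refl) = m≤m+n (f x) (∑ xs f)
∈⇒≤∑ {xs = x ∷ xs} f (there x∈) = ≤-trans (∈⇒≤∑ f x∈) (m≤n+m (∑ xs f) (f x))

∑-𝟙≤1 : {P : A → Set} (P? : Decidable P) {xs : List A} → Unique xs →
        (∀ {x y} → x ∈ xs → y ∈ xs → P x → P y → x ≡ y) → ∑ xs (𝟙 ∘ P?) ≤ 1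
∑-𝟙≤1 P? [] same = z≤n
∑-𝟙≤1 P? {x ∷ xs} (x∉xs ∷ u) same with P? x
... | no _ = ∑-𝟙≤1 P? u (λ y∈ z∈ → same (there y∈) (there z∈))
... | yes px = ≤-reflexive (cong suc (n≤0⇒n≡0 (begin
  ∑ xs (𝟙 ∘ P?)   ≤⟨ ∑-mono-∈ xs (λ {y} y∈ → ≤-reflexive (𝟙-no (P? y) λ py →
                       All.lookup x∉xs y∈ (same (here refl) (there y∈) px py))) ⟩
  ∑ xs (λ _ → 0)  ≡⟨ trans (∑-const xs 0) (*-zeroʳ (length xs)) ⟩
  0               ∎)))
  where open ≤-Reasoning

length-filter-∑ : {P : A → Set} (P? : Decidable P) (xs : List A) →
    length (filter P? xs) ≡ ∑ xs (𝟙 ∘ P?)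
length-filter-∑ P? [] = refl
length-filter-∑ P? (x ∷ xs) with P? x
... | yes _ = cong suc (length-filter-∑ P? xs)
... | no  _ = length-filter-∑ P? xs

-- The probabilistic method in counting form: a bound on a sum over all multipliers yields one
-- multiplier that is no worse than average.
average : ∀ (xs : List A) f → length xs ≢ 0 → ∃[ x ] x ∈ xs × length xs * f x ≤ ∑ xs f
average [] f ≢0 = contradiction refl ≢0
average (x ∷ []) f _ = x , here refl , ≤-refl
average (x ∷ xs@(_ ∷ _)) f _ with average xs f (λ ())
... | y , y∈ , avg with ≤-total (f x) (f y)
...   | inj₁ fx≤fy = x , here refl ,
        +-monoʳ-≤ (f x) (≤-trans (*-monoʳ-≤ (length xs) fx≤fy) avg)
...   | inj₂ fy≤fx = y , there y∈ , +-mono-≤ fy≤fx avg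

∑-upTo-+ : ∀ m n f → ∑ (upTo (m + n)) f ≡ ∑ (upTo m) f + ∑ (upTo n) (λ i → f (m + i))
∑-upTo-+ m n f = begin
  ∑ (upTo (m + n)) f                                ≡⟨ cong (λ xs → ∑ xs f) (split id m) ⟩
  ∑ (upTo m ++ applyUpTo (m +_) n) f                ≡⟨ ∑-++ (upTo m) _ f ⟩
  ∑ (upTo m) f + ∑ (applyUpTo (m +_) n) f
    ≡⟨ cong (∑ (upTo m) f +_) (reindex (m +_) id n) ⟩
  ∑ (upTo m) f + ∑ (upTo n) (λ i → f (m + i))       ∎
  where
  open ≡-Reasoning
  split : ∀ (h : ℕ → ℕ) m → applyUpTo h (m + n) ≡ applyUpTo h m ++ applyUpTo (h ∘ (m +_)) n
  split h zero    = refl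
  split h (suc m) = cong (h 0 ∷_) (split (h ∘ suc) m)
  reindex : ∀ (g h : ℕ → ℕ) n → ∑ (applyUpTo (g ∘ h) n) f ≡ ∑ (applyUpTo h n) (f ∘ g)
  reindex g h zero    = refl
  reindex g h (suc n) = cong (f (g (h 0)) +_) (reindex g (h ∘ suc) n)

-- Odd multiples modulo powers of two.

2^≢0 : ∀ b → NonZero (2 ^ b)
2^≢0 b = m^n≢0 2 b

infixl 7 _%2^_ _/2^_

_%2^_ _/2^_ : ℕ → ℕ → ℕ
m %2^ b = _%_ m (2 ^ b) {{2^≢0 b}}
m /2^ b = _/_ m (2 ^ b) {{2^≢0 b}}

odd-∤ : ∀ n → ¬ 2 ∣ suc (2 * n)
odd-∤ n 2∣ = contradiction (∣⇒≤ (∣m+n∣m⇒∣n (subst (2 ∣_) (+-comm 1 (2 * n)) 2∣) (m∣m*n n))) λ { (s≤s ()) }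

2∤⇒odd : ∀ n → ¬ 2 ∣ n → ∃[ k ] n ≡ suc (2 * k)
2∤⇒odd zero    ¬2∣ = contradiction (2 ∣0) ¬2∣
2∤⇒odd (suc n) ¬2∣ with 2 ∣? n
... | yes (divides k eqn) = k , cong suc (trans eqn (*-comm k 2))
... | no  ¬2∣n with 2∤⇒odd n ¬2∣n
...   | k , refl = contradiction (divides (suc k) (cong (2 +_) (*-comm 2 k))) ¬2∣

-- Since 2 is prime and does not divide `n`, the factors 2 can be stripped from `m` one at a time.
2^∣m*n⇒2^∣m : ∀ b {m n} → ¬ 2 ∣ n → 2 ^ b ∣ m * n → 2 ^ b ∣ m
2^∣m*n⇒2^∣m zero    _   _ = 1∣ _
2^∣m*n⇒2^∣m (suc b) {m} {n} 2∤n 2^∣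
  with euclidsLemma m n (from-yes (prime? 2)) (m*n∣⇒m∣ 2 (2 ^ b) 2^∣)
... | inj₂ 2∣n = contradiction 2∣n 2∤n
... | inj₁ (divides k refl) =
  subst (2 ^ suc b ∣_) (*-comm 2 k) (*-monoʳ-∣ 2 (2^∣m*n⇒2^∣m b {k} {n} 2∤n
    (*-cancelˡ-∣ 2 (subst (2 ^ suc b ∣_) (lemma k n) 2^∣))))
  where
  lemma : ∀ k n → k * 2 * n ≡ 2 * (k * n)
  lemma = solve-∀

%≡%⇒∣∸ : ∀ m n d .{{_ : NonZero d}} → m % d ≡ n % d → m ≤ n → d ∣ n ∸ m
%≡%⇒∣∸ m n d eqn m≤n = divides (n / d ∸ m / d) (begin
  n ∸ m
    ≡⟨ cong₂ _∸_ (m≡m%n+[m/n]*n n d) (m≡m%n+[m/n]*n m d) ⟩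
  (n % d + n / d * d) ∸ (m % d + m / d * d)
    ≡⟨ cong (λ r → (n % d + n / d * d) ∸ (r + m / d * d)) eqn ⟩
  (n % d + n / d * d) ∸ (n % d + m / d * d)      ≡⟨ [m+n]∸[m+o]≡n∸o (n % d) _ _ ⟩
  n / d * d ∸ m / d * d                          ≡⟨ *-distribʳ-∸ d (n / d) (m / d) ⟨
  (n / d ∸ m / d) * d                            ∎)
  where open ≡-Reasoning

-- Multipliers are indexed by their halves: as `a` runs below `2 ^ b`, `odd a` runs through all odd
-- residues modulo `2 ^ suc b`.
odd : ℕ → ℕ
odd a = suc (2 * a)

small? : ∀ b s z a → Dec (odd a * z %2^ b < 2 ^ s)
small? b s z a = odd a * z %2^ b <? 2 ^ s

odd*odd : ∀ a k → odd a * odd k ≡ odd (k + a * odd k)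
odd*odd = lemma
  where
  lemma : ∀ a k → suc (2 * a) * suc (2 * k) ≡ suc (2 * (k + a * suc (2 * k)))
  lemma = solve-∀

-- The products for `a` and `a + k` differ by `2 * (k * z)`. If `2 ^ suc b` divides this and `z` is
-- odd, then `2 ^ b` divides `k`, which is too small unless it is 0.
odd-*-injective : ∀ b {z a a′} → ¬ 2 ∣ z → a < 2 ^ b → a′ < 2 ^ b →
                  odd a * z %2^ suc b ≡ odd a′ * z %2^ suc b → a ≡ a′
odd-*-injective b {z} {a} {a′} 2∤z a< a′< eqn =
  [ (λ a≤a′ → le a≤a′ a′< eqn) , (λ a′≤a → sym (le a′≤a a< (sym eqn))) ]′ (≤-total a a′)
  where
  lemma : ∀ a k z → suc (2 * (a + k)) * z ≡ suc (2 * a) * z + 2 * (k * z)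
  lemma = solve-∀
  le : ∀ {a a′} → a ≤ a′ → a′ < 2 ^ b →
       odd a * z %2^ suc b ≡ odd a′ * z %2^ suc b → a ≡ a′
  le {a} {a′} a≤a′ a′< eqn with m≤n⇒∃[o]m+o≡n a≤a′
  ... | k , refl =
    sym (trans (cong (a +_) (k≡0 k (2^∣m*n⇒2^∣m b 2∤z
      (*-cancelˡ-∣ 2 (subst (2 ^ suc b ∣_)
        (trans (cong (_∸ odd a * z) (lemma a k z)) (m+n∸m≡n (odd a * z) _))
        (%≡%⇒∣∸ (odd a * z) (odd (a + k) * z) (2 ^ suc b) {{2^≢0 (suc b)}} eqn
          (*-monoˡ-≤ z (s≤s (*-monoʳ-≤ 2 a≤a′)))))))
      (≤-<-trans (m≤n+m k a) a′<))) (+-identityʳ a))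
    where
    k≡0 : ∀ k → 2 ^ b ∣ k → k < 2 ^ b → k ≡ 0
    k≡0 zero    _   _  = refl
    k≡0 (suc k) 2^∣ k< = contradiction (∣⇒≤ 2^∣) (<⇒≱ k<)

-- An odd multiple of an odd number leaves an odd residue, as the modulus is even. Only `h` odd
-- residues lie below `2 ^ s` (none if `s` is 0), and by injectivity at most one multiplier reaches
-- each.
small-odd : ∀ b s {z} → ¬ 2 ∣ z → 2 * ∑ (upTo (2 ^ b)) (𝟙 ∘ small? (suc b) s z) ≤ 2 ^ s
small-odd b s {z} 2∤z = begin
  2 * ∑ (upTo (2 ^ b)) (𝟙 ∘ small? (suc b) s z)
    ≤⟨ *-monoʳ-≤ 2 (∑-mono (upTo (2 ^ b)) hits) ⟩
  2 * ∑ (upTo (2 ^ b)) (λ a → ∑ (upTo h) (λ r → 𝟙 (hit? r a)))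
    ≡⟨ cong (2 *_) (∑-swap (upTo (2 ^ b)) (upTo h) (λ a r → 𝟙 (hit? r a))) ⟩
  2 * ∑ (upTo h) (λ r → ∑ (upTo (2 ^ b)) (λ a → 𝟙 (hit? r a)))
    ≤⟨ *-monoʳ-≤ 2 (∑-mono (upTo h) (λ r → ∑-𝟙≤1 (hit? r) (upTo⁺ (2 ^ b)) (λ x∈ y∈ p q →
         odd-*-injective b 2∤z (∈-upTo⁻ x∈) (∈-upTo⁻ y∈) (trans p (sym q))))) ⟩
  2 * ∑ (upTo h) (λ _ → 1)
    ≡⟨ cong (2 *_) (trans (∑-const (upTo h) 1) (trans (*-identityʳ _) (length-upTo h))) ⟩
  2 * h
    ≡⟨ *-comm 2 h ⟩
  h * 2
    ≤⟨ m/n*n≤m (2 ^ s) 2 ⟩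
  2 ^ s ∎
  where
  open ≤-Reasoning
  h = 2 ^ s / 2
  hit? : ∀ r a → Dec (odd a * z %2^ suc b ≡ odd r)
  hit? r a = odd a * z %2^ suc b ℕ.≟ odd r
  halve : ∀ r → odd r < 2 ^ s → r < h
  halve r lt′ = *-cancelʳ-< 2 r h (+-cancelʳ-< (2 ^ s % 2) (r * 2) (h * 2) (begin-strict
    r * 2 + 2 ^ s % 2     ≤⟨ +-monoʳ-≤ (r * 2) (≤-pred (m%n<n (2 ^ s) 2)) ⟩
    r * 2 + 1             ≡⟨ trans (+-comm (r * 2) 1) (cong suc (*-comm r 2)) ⟩
    odd r                 <⟨ lt′ ⟩
    2 ^ s                 ≡⟨ m≡m%n+[m/n]*n (2 ^ s) 2 ⟩
    2 ^ s % 2 + h * 2     ≡⟨ +-comm (2 ^ s % 2) _ ⟩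
    h * 2 + 2 ^ s % 2     ∎))
  residue-odd : ∀ a → ¬ 2 ∣ odd a * z %2^ suc b
  residue-odd a 2∣r with k , refl ← 2∤⇒odd z 2∤z = odd-∤ (k + a * odd k) (subst (2 ∣_) (odd*odd a k)
    (∣n∣m%n⇒∣m {{2^≢0 (suc b)}} (m∣m*n (2 ^ b)) 2∣r))
  hits : ∀ a → 𝟙 (small? (suc b) s z a) ≤ ∑ (upTo h) (λ r → 𝟙 (hit? r a))
  hits a with small? (suc b) s z a
  ... | no  _ = z≤n
  ... | yes lt′ with r , eqn ← 2∤⇒odd _ (residue-odd a) = begin
    1                                    ≡⟨ 𝟙-yes (hit? r a) eqn ⟨
    𝟙 (hit? r a)
      ≤⟨ ∈⇒≤∑ (λ r → 𝟙 (hit? r a)) (∈-upTo⁺ (halve r (subst (_< 2 ^ s) eqn lt′))) ⟩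
    ∑ (upTo h) (λ r → 𝟙 (hit? r a))      ∎

-- Dividing an even z by 2 halves both the modulus and the bound 2 ^ s, and makes every
-- multiplier count twice.  For odd z multiplication by z permutes the odd residues.
small-count : ∀ b s z → ¬ 2 ^ suc b ∣ z → 2 * ∑ (upTo (2 ^ b)) (𝟙 ∘ small? (suc b) s z) ≤ 2 ^ s
small-count b s z ∤z with 2 ∣? z
... | no  2∤z = small-odd b s 2∤z
small-count zero    s z ∤z | yes 2∣z = contradiction 2∣z ∤z
small-count (suc b) s z ∤z | yes (divides z′ refl) = begin
  2 * ∑ (upTo (2 ^ suc b)) (𝟙 ∘ small? (suc (suc b)) s (z′ * 2))
    ≤⟨ *-monoʳ-≤ 2 (∑-mono (upTo (2 ^ suc b)) λ a →
         𝟙-mono (small? (suc (suc b)) s (z′ * 2) a) (small? (suc b) (pred s) z′ a) (half a s)) ⟩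
  2 * ∑ (upTo (2 * 2 ^ b)) c
    ≡⟨ cong (λ m → 2 * ∑ (upTo (2 ^ b + m)) c) (+-identityʳ (2 ^ b)) ⟩
  2 * ∑ (upTo (2 ^ b + 2 ^ b)) c
    ≡⟨ cong (2 *_) (∑-upTo-+ (2 ^ b) (2 ^ b) c) ⟩
  2 * (∑ (upTo (2 ^ b)) c + ∑ (upTo (2 ^ b)) (λ a → c (2 ^ b + a)))
    ≡⟨ cong (λ m → 2 * (∑ (upTo (2 ^ b)) c + m)) (∑-cong (upTo (2 ^ b)) periodic) ⟩
  2 * (∑ (upTo (2 ^ b)) c + ∑ (upTo (2 ^ b)) c)
    ≡⟨ cong (λ m → 2 * (∑ (upTo (2 ^ b)) c + m)) (+-identityʳ _) ⟨
  2 * (2 * ∑ (upTo (2 ^ b)) c)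
    ≤⟨ double s (∑ (upTo (2 ^ b)) c)
         (small-count b (pred s) z′ (λ d →
             ∤z (subst (_∣ z′ * 2) (*-comm (2 ^ suc b) 2) (*-monoˡ-∣ 2 d)))) ⟩
  2 ^ s ∎
  where
  open ≤-Reasoning
  c : ℕ → ℕ
  c = 𝟙 ∘ small? (suc b) (pred s) z′
  half : ∀ a s → odd a * (z′ * 2) %2^ suc (suc b) < 2 ^ s → odd a * z′ %2^ suc b < 2 ^ pred s
  half a s lt′ = halve s (subst (_< 2 ^ s) (trans
      (cong (_%2^ suc (suc b)) (sym (*-assoc (odd a) z′ 2)))
      (trans (%-congʳ {m = 2 ^ suc (suc b)} {n =
          2 ^ suc b * 2} {{2^≢0 (suc (suc b))}} {{m*n≢0 (2 ^ suc b) 2 {{2^≢0 (suc b)}}}}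
              (*-comm 2 (2 ^ suc b)))
             (sym (m%n*o≡m*o%[n*o] (odd a * z′)
                 (2 ^ suc b) 2 {{2^≢0 (suc b)}} {{m*n≢0 (2 ^ suc b) 2 {{2^≢0 (suc b)}}}})))) lt′)
    where
    halve : ∀ s {r} → r * 2 < 2 ^ s → r < 2 ^ pred s
    halve zero    {zero}  _  = s≤s z≤n
    halve zero    {suc r} (s≤s ())
    halve (suc s) {r}     lt′ = *-cancelʳ-< 2 r (2 ^ s) (subst (r * 2 <_) (*-comm 2 (2 ^ s)) lt′)
  periodic : ∀ a → c (2 ^ b + a) ≡ c a
  periodic a = cong (λ r → 𝟙 (r <? 2 ^ pred s)) (trans
    (cong (_%2^ suc b) (shift (2 ^ b) a z′))
        ([m+kn]%n≡m%n (odd a * z′) z′ (2 ^ suc b) {{2^≢0 (suc b)}}))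
    where
    shift : ∀ p a z → suc (2 * (p + a)) * z ≡ suc (2 * a) * z + z * (2 * p)
    shift = solve-∀
  -- At `s = 0` the predecessor does not halve the bound, but `2 * m ≤ 1` already forces `m = 0`.
  double : ∀ s m → 2 * m ≤ 2 ^ pred s → 2 * (2 * m) ≤ 2 ^ s
  double zero    zero    _  = z≤n
  double zero    (suc m) le = contradiction le (λ { (s≤s le′) → contradiction (subst (_≤ 0) (+-suc m (m + 0)) le′) λ () })
  double (suc s) m       le = *-monoʳ-≤ 2 le

-- Multiply-shift hashing

hashℕ : ∀ b s a x → ℕ
hashℕ b s a x = (a * x %2^ b) /2^ s

/2^-close : ∀ s {u v} → u /2^ s ≡ v /2^ s → v ∸ u < 2 ^ s
/2^-close s {u} {v} eqn = begin-strict
  v ∸ u                                       ≡⟨ cong (_∸ u) (m≡m%n+[m/n]*n v (2 ^ s)) ⟩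
  v % 2 ^ s + v /2^ s * 2 ^ s ∸ u
    ≤⟨ ∸-monoʳ-≤ _ (subst (λ q → q * 2 ^ s ≤ u) eqn (m/n*n≤m u (2 ^ s))) ⟩
  v % 2 ^ s + v /2^ s * 2 ^ s ∸ v /2^ s * 2 ^ s  ≡⟨ m+n∸n≡m (v % 2 ^ s) (v /2^ s * 2 ^ s) ⟩
  v % 2 ^ s                                   <⟨ m%n<n v (2 ^ s) ⟩
  2 ^ s                                       ∎
  where
  open ≤-Reasoning
  instance _ = 2^≢0 s

-- `y + (2 ^ b ∸ x)` represents `y - x` modulo `2 ^ b` for either order of `x` and `y`. Both sides
-- are congruent, and the right one is already reduced.
%2^-difference : ∀ b a x y → x ≤ 2 ^ b → a * x %2^ b ≤ a * y %2^ b →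
                 a * (y + (2 ^ b ∸ x)) %2^ b ≡ a * y %2^ b ∸ a * x %2^ b
%2^-difference b a x y x≤ u≤v = begin
  z % N                       ≡⟨ [m+kn]%n≡m%n z k N ⟨
  (z + k * N) % N             ≡⟨ cong (_% N) (+-cancelʳ-≡ u _ _ balance) ⟩
  (v ∸ u + (l + a) * N) % N   ≡⟨ [m+kn]%n≡m%n (v ∸ u) (l + a) N ⟩
  (v ∸ u) % N                 ≡⟨ m<n⇒m%n≡m (≤-<-trans (m∸n≤m v u) (m%n<n (a * y) N)) ⟩
  v ∸ u                       ∎
  where
  open ≡-Reasoning
  instance _ = 2^≢0 b
  N = 2 ^ b
  u = a * x %2^ b
  v = a * y %2^ b
  k = a * x / N
  l = a * y / N
  z = a * (y + (N ∸ x))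
  expand : ∀ a y c x → a * (y + c) + a * x ≡ a * y + a * (c + x)
  expand = solve-∀
  regroup : ∀ v l N a → v + l * N + a * N ≡ v + (l + a) * N
  regroup = solve-∀
  balance : z + k * N + u ≡ v ∸ u + (l + a) * N + u
  balance = begin
    z + k * N + u                ≡⟨ trans (+-assoc z _ u) (cong (z +_) (+-comm (k * N) u)) ⟩
    z + (u + k * N)              ≡⟨ cong (z +_) (m≡m%n+[m/n]*n (a * x) N) ⟨
    z + a * x                    ≡⟨ expand a y (N ∸ x) x ⟩
    a * y + a * (N ∸ x + x)
      ≡⟨ cong₂ (λ m n → m + a * n) (m≡m%n+[m/n]*n (a * y) N) (m∸n+n≡m x≤) ⟩
    v + l * N + a * N            ≡⟨ regroup v l N a ⟩
    v + (l + a) * N              ≡⟨ cong (_+ (l + a) * N) (m∸n+n≡m u≤v) ⟨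
    v ∸ u + u + (l + a) * N
      ≡⟨ trans (+-assoc (v ∸ u) u _) (trans (cong (v ∸ u +_) (+-comm u _))
           (sym (+-assoc (v ∸ u) _ u))) ⟩
    v ∸ u + (l + a) * N + u      ∎

2^∤-difference : ∀ b {x y} → x < 2 ^ b → y < 2 ^ b → x ≢ y → ¬ 2 ^ b ∣ y + (2 ^ b ∸ x)
2^∤-difference b {x} {y} x< y< x≢y N∣ with <-cmp x y
... | tri≈ _ x≡y _ = x≢y x≡y
... | tri< x<y _ _ = <⇒≱ (≤-<-trans (m∸n≤m y x) y<)
  (∣⇒≤ {{≢-nonZero (m<n⇒n≢0 (m<n⇒0<n∸m x<y))}} (∣m+n∣m⇒∣n (subst (2 ^ b ∣_) rearrange N∣) ∣-refl))
  where
  rearrange : y + (2 ^ b ∸ x) ≡ 2 ^ b + (y ∸ x)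
  rearrange = trans (sym (+-∸-assoc y (<⇒≤ x<)))
      (trans (cong (_∸ x) (+-comm y (2 ^ b))) (+-∸-assoc (2 ^ b) (<⇒≤ x<y)))
... | tri> _ _ y<x = <⇒≱ (subst (y + (2 ^ b ∸ x) <_) (m+[n∸m]≡n (<⇒≤ x<)) (+-monoˡ-< (2 ^ b ∸ x) y<x))
  (∣⇒≤ {{≢-nonZero (m<n⇒n≢0 (<-≤-trans (m<n⇒0<n∸m x<) (m≤n+m (2 ^ b ∸ x) y)))}} N∣)

-- If x and y collide, then a (y - x) or a (x - y) is less than 2 ^ s modulo 2 ^ b.
collision-count : ∀ b s {x y} → x < 2 ^ suc b → y < 2 ^ suc b → x ≢ y →
  ∑ (upTo (2 ^ b)) (λ a → 𝟙 (hashℕ (suc b) s (odd a) x ℕ.≟ hashℕ (suc b) s (odd a) y)) ≤ 2 ^ s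
collision-count b s {x} {y} x< y< x≢y = *-cancelˡ-≤ 2 (begin
  2 * ∑ R (λ a → 𝟙 (collide? a))               ≤⟨ *-monoʳ-≤ 2 (∑-mono R close) ⟩
  2 * ∑ R (λ a → c x y a + c y x a)            ≡⟨ cong (2 *_) (∑-distrib-+ R (c x y) (c y x)) ⟩
  2 * (∑ R (c x y) + ∑ R (c y x))              ≡⟨ *-distribˡ-+ 2 (∑ R (c x y)) (∑ R (c y x)) ⟩
  2 * ∑ R (c x y) + 2 * ∑ R (c y x)
    ≤⟨ +-mono-≤ (small-count b s (y + (N ∸ x)) (2^∤-difference (suc b) x< y< x≢y))
                (small-count b s (x + (N ∸ y)) (2^∤-difference (suc b) y< x< (x≢y ∘ sym))) ⟩
  2 ^ s + 2 ^ s                                ≡⟨ cong (2 ^ s +_) (+-identityʳ (2 ^ s)) ⟨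
  2 * 2 ^ s                                    ∎)
  where
  open ≤-Reasoning
  N = 2 ^ suc b
  R = upTo (2 ^ b)
  c : ℕ → ℕ → ℕ → ℕ
  c x y a = 𝟙 (small? (suc b) s (y + (N ∸ x)) a)
  collide? : ∀ a → Dec (hashℕ (suc b) s (odd a) x ≡ hashℕ (suc b) s (odd a) y)
  collide? a = hashℕ (suc b) s (odd a) x ℕ.≟ hashℕ (suc b) s (odd a) y
  one : ∀ {x y} a → x < N → hashℕ (suc b) s (odd a) x ≡ hashℕ (suc b) s (odd a) y →
        odd a * x %2^ suc b ≤ odd a * y %2^ suc b → c x y a ≡ 1
  one {x} {y} a x< eqn le = 𝟙-yes (small? (suc b) s (y + (N ∸ x)) a)
    (subst (_< 2 ^ s) (sym (%2^-difference (suc b) (odd a) x y (<⇒≤ x<) le)) (/2^-close s eqn))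
  close : ∀ a → 𝟙 (collide? a) ≤ c x y a + c y x a
  close a with collide? a
  ... | no  _  = z≤n
  ... | yes eqn with ≤-total (odd a * x %2^ suc b) (odd a * y %2^ suc b)
  ...   | inj₁ u≤v = ≤-trans (≤-reflexive (sym (one a x< eqn u≤v))) (m≤m+n (c x y a) (c y x a))
  ...   | inj₂ v≤u = ≤-trans (≤-reflexive (sym (one a y< (sym eqn) v≤u))) (m≤n+m (c y x a) (c x y a))

-- Hash functions on machine words.

value-wrap : ∀ b x → value (wrap {b} x) ≡ x %2^ b
value-wrap b x = toℕ-fromℕ< (m%n<n x (2 ^ b) {{2^≢0 b}})

value-wrap-< : ∀ {x} → x < 2 ^ b → value (wrap {b} x) ≡ x
value-wrap-< {b} {x} x< = trans (value-wrap b x) (m<n⇒m%n≡m {{2^≢0 b}} x<)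

value<2^ : (x : Word b) → value x < 2 ^ b
value<2^ x = toℕ<n (index x)

value-injective : {x y : Word b} → value x ≡ value y → x ≡ y
value-injective eqn = cong word (toℕ-injective eqn)

hash : Word b → Word b → Word b → Word b
hash a s x = ⟦ shr ⟧ (⟦ mul ⟧ a x) s

value-hash : (a s x : Word b) → value (hash a s x) ≡ hashℕ b (value s) (value a) (value x)
value-hash {b} a s x = begin
  value (wrap {b} (value (wrap {b} m) /2^ value s))
    ≡⟨ value-wrap b (value (wrap {b} m) /2^ value s) ⟩
  value (wrap {b} m) /2^ value s %2^ b
    ≡⟨ cong (λ r → r /2^ value s %2^ b) (value-wrap b m) ⟩
  m %2^ b /2^ value s %2^ b
    ≡⟨ m<n⇒m%n≡m {{2^≢0 b}} (≤-<-trans (m/n≤m (m %2^ b) (2 ^ value s) {{2^≢0 (value s)}})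
         (m%n<n m (2 ^ b) {{2^≢0 b}})) ⟩
  m %2^ b /2^ value s                            ∎
  where
  open ≡-Reasoning
  m = value a * value x

n<2^n : ∀ n → n < 2 ^ n
n<2^n zero    = s≤s z≤n
n<2^n (suc n) = +-mono-≤ (m^n>0 2 n) (≤-trans (n<2^n n) (m≤m+n (2 ^ n) 0))

-- A multiply-shift hash function with 2 ^ ℓ values shifts by b ∸ ℓ.
shift : ℕ → Word b
shift {b} ℓ = wrap (b ∸ ℓ)

value-shift : ∀ ℓ → value (shift {b} ℓ) ≡ b ∸ ℓ
value-shift {b} ℓ = value-wrap-< {b} (≤-<-trans (m∸n≤m b ℓ) (n<2^n b))

hash<2^ : ∀ {ℓ} → ℓ ≤ b → (a x : Word b) → value (hash a (shift ℓ) x) < 2 ^ ℓ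
hash<2^ {b} {ℓ} ℓ≤b a x = subst (_< 2 ^ ℓ) (sym (value-hash a (shift ℓ) x))
  (m<n*o⇒m/o<n {{2^≢0 (value (shift {b} ℓ))}} (subst (value a * value x %2^ b <_) split
    (m%n<n (value a * value x) (2 ^ b) {{2^≢0 b}})))
  where
  split : 2 ^ b ≡ 2 ^ ℓ * 2 ^ value (shift {b} ℓ)
  split = trans (cong (2 ^_) (sym (trans (cong (ℓ +_) (value-shift {b} ℓ)) (m+[n∸m]≡n ℓ≤b))))
                (^-distribˡ-+-* 2 ℓ (value (shift {b} ℓ)))

Collide : Word b → Word b → Word b → Word b → Set
Collide a s x y = x ≢ y × hash a s x ≡ hash a s y

collide? : (a s x y : Word b) → Dec (Collide a s x y)
collide? a s x y = ¬? (x ≟ y) ×-dec (hash a s x ≟ hash a s y)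

-- Pairs are ordered, so every colliding pair counts twice.
collisions : Word b → Word b → List (Word b) → ℕ
collisions a s ks = ∑ ks λ x → ∑ ks λ y → 𝟙 (collide? a s x y)

-- Each of the `k * k` ordered pairs collides under at most `2 ^ value s` of the `2 ^ b` odd
-- multipliers. An average multiplier thus has at most `k * k * 2 ^ value s / 2 ^ b` collisions, and
-- `2 ^ ℓ * 2 ^ value s` is `2 ^ suc b`; the bound is multiplied out to avoid division.
few-collisions : ∀ ℓ (ks : List (Word (suc b))) → ℓ ≤ suc b →
                 ∃[ a ] collisions a (shift ℓ) ks * 2 ^ ℓ ≤ 2 * (length ks * length ks)
few-collisions {b} ℓ ks ℓ≤ = choose
    (average R f (λ eqn → m<n⇒n≢0 (m^n>0 2 b) (trans (sym (length-upTo (2 ^ b))) eqn)))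
  where
  open ≤-Reasoning
  R = upTo (2 ^ b)
  s : Word (suc b)
  s = shift ℓ
  k = length ks
  f : ℕ → ℕ
  f a = collisions (wrap (odd a)) s ks
  pair : ∀ x y → ∑ R (λ a → 𝟙 (collide? (wrap (odd a)) s x y)) ≤ 2 ^ value s
  pair x y with value x ℕ.≟ value y
  ... | yes eqn = begin
    ∑ R (λ a → 𝟙 (collide? (wrap (odd a)) s x y))
      ≡⟨ ∑-cong R (λ a → 𝟙-no (collide? (wrap (odd a)) s x y)
           (λ c → proj₁ c (value-injective eqn))) ⟩
    ∑ R (λ _ → 0) ≡⟨ trans (∑-const R 0) (*-zeroʳ (length R)) ⟩
    0             ≤⟨ z≤n ⟩
    2 ^ value s   ∎
  ... | no  x≢y = ≤-trans
    (∑-mono-∈ R λ {a} a∈ → 𝟙-mono (collide? (wrap (odd a)) s x y)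
      (hashℕ (suc b) (value s) (odd a) (value x) ℕ.≟ hashℕ (suc b) (value s) (odd a) (value y))
      λ (_ , eqn) → trans (sym (hash-odd a∈ x)) (trans (cong value eqn) (hash-odd a∈ y)))
    (collision-count b (value s) (value<2^ x) (value<2^ y) x≢y)
    where
    hash-odd : ∀ {a} → a ∈ R → ∀ x →
        value (hash (wrap (odd a)) s x) ≡ hashℕ (suc b) (value s) (odd a) (value x)
    hash-odd {a} a∈ x = trans (value-hash (wrap (odd a)) s x)
      (cong (λ m → hashℕ (suc b) (value s) m (value x))
        (value-wrap-< {suc b} (≤-trans (≤-reflexive (sym (*-suc 2 a))) (*-monoʳ-≤ 2 (∈-upTo⁻ a∈)))))
  total : ∑ R f ≤ k * k * 2 ^ value s
  total = begin
    ∑ R f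
      ≡⟨ ∑-swap R ks (λ a x → ∑ ks (λ y → 𝟙 (collide? (wrap (odd a)) s x y))) ⟩
    ∑ ks (λ x → ∑ R (λ a → ∑ ks (λ y → 𝟙 (collide? (wrap (odd a)) s x y))))
      ≡⟨ ∑-cong ks (λ x → ∑-swap R ks (λ a y → 𝟙 (collide? (wrap (odd a)) s x y))) ⟩
    ∑ ks (λ x → ∑ ks (λ y → ∑ R (λ a → 𝟙 (collide? (wrap (odd a)) s x y))))
      ≤⟨ ∑-mono ks (λ x → ∑-mono ks (pair x)) ⟩
    ∑ ks (λ x → ∑ ks (λ y → 2 ^ value s))
      ≡⟨ trans (∑-cong ks (λ _ → ∑-const ks (2 ^ value s))) (∑-const ks (k * 2 ^ value s)) ⟩
    k * (k * 2 ^ value s)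
      ≡⟨ *-assoc k k (2 ^ value s) ⟨
    k * k * 2 ^ value s ∎
  lhs : ∀ p f q → f * q * (2 * p) ≡ 2 * q * (p * f)
  lhs = solve-∀
  rhs : ∀ q kk t → 2 * q * (kk * t) ≡ 2 * kk * (q * t)
  rhs = solve-∀
  choose : ∃[ a ] a ∈ R × length R * f a ≤ ∑ R f → ∃[ a ] collisions a s ks * 2 ^ ℓ ≤ 2 * (k * k)
  choose (a , _ , avg) = wrap (odd a) , *-cancelʳ-≤ _ _ (2 ^ suc b) {{2^≢0 (suc b)}} (begin
    f a * 2 ^ ℓ * (2 * 2 ^ b)        ≡⟨ lhs (2 ^ b) (f a) (2 ^ ℓ) ⟩
    2 * 2 ^ ℓ * (2 ^ b * f a)
      ≤⟨ *-monoʳ-≤ (2 * 2 ^ ℓ) (≤-trans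
           (subst (λ r → r * f a ≤ ∑ R f) (length-upTo (2 ^ b)) avg) total) ⟩
    2 * 2 ^ ℓ * (k * k * 2 ^ value s) ≡⟨ rhs (2 ^ ℓ) (k * k) (2 ^ value s) ⟩
    2 * (k * k) * (2 ^ ℓ * 2 ^ value s) ≡⟨ cong (2 * (k * k) *_) split ⟨
    2 * (k * k) * 2 ^ suc b          ∎)
    where
    split : 2 ^ suc b ≡ 2 ^ ℓ * 2 ^ value s
    split = trans (cong (2 ^_) (sym (trans (cong (ℓ +_) (value-shift {suc b} ℓ)) (m+[n∸m]≡n ℓ≤))))
                  (^-distribˡ-+-* 2 ℓ (value s))

-- Two-level hash tables

power-above : ∀ m → ∃[ ℓ ] m < 2 ^ ℓ × 2 ^ ℓ ≤ 2 * m + 1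
power-above zero = 0 , s≤s z≤n , ≤-refl
power-above (suc m) with power-above m
... | ℓ , m< , ≤2m+1 with suc m <? 2 ^ ℓ
...   | yes 1+m< = ℓ , 1+m< , ≤-trans ≤2m+1 (+-monoˡ-≤ 1 (*-monoʳ-≤ 2 (n≤1+n m)))
...   | no  1+m≮ = suc ℓ , ≤-trans (s≤s (s≤s (m≤m+n m (m + 0)))) (≤-trans (≤-reflexive (sym (*-suc 2 m))) (*-monoʳ-≤ 2 m<))
                 , ≤-trans (*-monoʳ-≤ 2 (≮⇒≥ 1+m≮)) (m≤m+n (2 * suc m) 1)

2^-cancel-≤ : ∀ {m n} → 2 ^ m ≤ 2 ^ n → m ≤ n
2^-cancel-≤ {m} {n} le with m ≤? n
... | yes m≤n = m≤n
... | no  m≰n = contradiction le (<⇒≱ (^-monoʳ-< 2 (s≤s (s≤s z≤n)) (≰⇒> m≰n)))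

record Perfect (ks : List (Word b)) : Set where
  field
    bits       : ℕ
    bits≤      : bits ≤ b
    size≤      : 2 ^ bits ≤ 4 * (length ks * length ks) + 1
    multiplier : Word b
    injective  : ∀ {x y} → x ∈ ks → y ∈ ks →
                 hash multiplier (shift bits) x ≡ hash multiplier (shift bits) y → x ≡ y

-- With more than `2 * (k * k)` slots, `few-collisions` leaves fewer than one collision, hence none.
-- The hypothesis keeps the number of hash bits within the word size.
perfect : (ks : List (Word (suc b))) → 4 * (length ks * length ks) + 1 ≤ 2 ^ suc b → Perfect ks
perfect {b} ks fits = build (power-above (2 * (k * k)))
  where
  k = length ks
  2*2* : ∀ m → 2 * (2 * m) + 1 ≡ 4 * m + 1
  2*2* = solve-∀
  build : ∃[ ℓ ] 2 * (k * k) < 2 ^ ℓ × 2 ^ ℓ ≤ 2 * (2 * (k * k)) + 1 → Perfect ks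
  build (ℓ , m< , ≤m) = collisionless (few-collisions ℓ ks ℓ≤)
    where
    size≤ = ≤-trans ≤m (≤-reflexive (2*2* (k * k)))
    ℓ≤ = 2^-cancel-≤ {ℓ} {suc b} (≤-trans size≤ fits)
    collisionless : ∃[ a ] collisions a (shift ℓ) ks * 2 ^ ℓ ≤ 2 * (k * k) → Perfect ks
    collisionless (a , few) = record
      { bits = ℓ ; bits≤ = ℓ≤ ; size≤ = size≤ ; multiplier = a ; injective = inj }
      where
      none : collisions a (shift ℓ) ks < 1
      none = *-cancelʳ-< (2 ^ ℓ) _ 1 (≤-<-trans few
          (<-≤-trans m< (≤-reflexive (sym (*-identityˡ (2 ^ ℓ))))))
      inj : ∀ {x y} → x ∈ ks → y ∈ ks → hash a (shift ℓ) x ≡ hash a (shift ℓ) y → x ≡ y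
      inj {x} {y} x∈ y∈ eqn with x ≟ y
      ... | yes x≡y = x≡y
      ... | no  x≢y = contradiction none (≤⇒≯ (begin
        1                                             ≡⟨ 𝟙-yes (collide? a (shift ℓ) x y)
            (x≢y , eqn) ⟨
        𝟙 (collide? a (shift ℓ) x y)
          ≤⟨ ∈⇒≤∑ (λ y → 𝟙 (collide? a (shift ℓ) x y)) y∈ ⟩
        ∑ ks (λ y → 𝟙 (collide? a (shift ℓ) x y))
          ≤⟨ ∈⇒≤∑ (λ x → ∑ ks (λ y → 𝟙 (collide? a (shift ℓ) x y))) x∈ ⟩
        collisions a (shift ℓ) ks                     ∎))
        where open ≤-Reasoning

bucket : Word b → Word b → List (Word b) → ℕ → List (Word b)
bucket a s ks j = filter (λ x → value (hash a s x) ℕ.≟ j) ks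

∑-*-∑ : ∀ (xs : List A) (ys : List B) f g → ∑ xs f * ∑ ys g ≡ ∑ xs (λ x → ∑ ys (λ y → f x * g y))
∑-*-∑ []       ys f g = refl
∑-*-∑ (x ∷ xs) ys f g = trans (*-distribʳ-+ (∑ ys g) (f x) (∑ xs f))
  (cong₂ _+_ (∑-distribˡ-* (f x) ys g) (∑-*-∑ xs ys f g))

-- The square of a bucket's size counts the ordered pairs inside it. Such a pair is a collision or
-- lies on the diagonal, and the diagonal has `length ks` elements because the keys are distinct.
∑-bucket² : ∀ n (a s : Word b) {ks} → Unique ks →
  ∑ (upTo n) (λ j → length (bucket a s ks j) * length (bucket a s ks j))
      ≤ collisions a s ks + length ks
∑-bucket² n a s {ks} u = begin
  ∑ R (λ j → length (bucket a s ks j) * length (bucket a s ks j))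
    ≡⟨ ∑-cong R (λ j → trans (cong (λ k → k * k)
         (length-filter-∑ (λ x → value (hash a s x) ℕ.≟ j) ks))
                             (∑-*-∑ ks ks (λ x → h x j) (λ x → h x j))) ⟩
  ∑ R (λ j → ∑ ks (λ x → ∑ ks (λ y → h x j * h y j)))
    ≡⟨ ∑-swap R ks (λ j x → ∑ ks (λ y → h x j * h y j)) ⟩
  ∑ ks (λ x → ∑ R (λ j → ∑ ks (λ y → h x j * h y j)))
    ≡⟨ ∑-cong ks (λ x → ∑-swap R ks (λ j y → h x j * h y j)) ⟩
  ∑ ks (λ x → ∑ ks (λ y → ∑ R (λ j → h x j * h y j)))
    ≤⟨ ∑-mono ks (λ x → ∑-mono ks (pair x)) ⟩
  ∑ ks (λ x → ∑ ks (λ y → 𝟙 (collide? a s x y) + 𝟙 (x ≟ y)))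
    ≡⟨ ∑-cong ks (λ x → ∑-distrib-+ ks (λ y → 𝟙 (collide? a s x y)) (λ y → 𝟙 (x ≟ y))) ⟩
  ∑ ks (λ x → ∑ ks (λ y → 𝟙 (collide? a s x y)) + ∑ ks (λ y → 𝟙 (x ≟ y)))
    ≡⟨ ∑-distrib-+ ks (λ x → ∑ ks (λ y → 𝟙 (collide? a s x y))) (λ x → ∑ ks (λ y → 𝟙 (x ≟ y))) ⟩
  collisions a s ks + ∑ ks (λ x → ∑ ks (λ y → 𝟙 (x ≟ y)))
    ≤⟨ +-monoʳ-≤ (collisions a s ks) (∑-mono ks λ x → ∑-𝟙≤1 (x ≟_) u λ _ _ p q → trans (sym p) q) ⟩
  collisions a s ks + ∑ ks (λ _ → 1)
    ≡⟨ cong (collisions a s ks +_) (trans (∑-const ks 1) (*-identityʳ _)) ⟩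
  collisions a s ks + length ks ∎
  where
  open ≤-Reasoning
  R = upTo n
  h : _ → ℕ → ℕ
  h x j = 𝟙 (value (hash a s x) ℕ.≟ j)
  pair : ∀ x y → ∑ R (λ j → h x j * h y j) ≤ 𝟙 (collide? a s x y) + 𝟙 (x ≟ y)
  pair x y with hash a s x ≟ hash a s y
  ... | yes eqn = begin
    ∑ R (λ j → h x j * h y j)
      ≤⟨ ∑-mono R (λ j → ≤-trans (*-monoʳ-≤ (h x j) (𝟙≤1 (value (hash a s y) ℕ.≟ j)))
           (≤-reflexive (*-identityʳ (h x j)))) ⟩
    ∑ R (h x)
      ≤⟨ ∑-𝟙≤1 (value (hash a s x) ℕ.≟_) (upTo⁺ n) (λ _ _ p q → trans (sym p) q) ⟩
    1
      ≤⟨ cover ⟩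
    𝟙 (¬? (x ≟ y) ×-dec yes eqn) + 𝟙 (x ≟ y) ∎
    where
    cover : 1 ≤ 𝟙 (¬? (x ≟ y) ×-dec yes eqn) + 𝟙 (x ≟ y)
    cover with x ≟ y
    ... | yes _ = s≤s z≤n
    ... | no  _ = s≤s z≤n
  ... | no  hx≢hy = begin
    ∑ R (λ j → h x j * h y j)
      ≡⟨ ∑-cong R disjoint ⟩
    ∑ R (λ _ → 0)
      ≡⟨ trans (∑-const R 0) (*-zeroʳ (length R)) ⟩
    0
      ≤⟨ z≤n ⟩
    _ ∎
    where
    disjoint : ∀ j → h x j * h y j ≡ 0
    disjoint j with value (hash a s x) ℕ.≟ j
    ... | no  _  = refl
    ... | yes p = cong (_+ 0) (𝟙-no (value (hash a s y) ℕ.≟ j) λ q → hx≢hy (value-injective (trans p (sym q))))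

-- The squares of the bucket sizes add up to O(|ks|), so every bucket can afford a
-- collision-free table of quadratic size.
record TwoLevel (ks : List (Word b)) : Set where
  field
    bits       : ℕ
    bits≤      : bits ≤ b
    multiplier : Word b
  keys : ℕ → List (Word b)
  keys = bucket multiplier (shift bits) ks
  field
    level₂ : ∀ j → Perfect (keys j)
    size₁  : 2 ^ bits ≤ 2 * length ks + 1
    size₂  : ∑ (upTo (2 ^ bits)) (λ j → length (keys j) * length (keys j)) ≤ 3 * length ks

-- More than `k` first-level slots bring the collisions down to `2 * k`; the diagonal adds `k`,
-- which gives the 3 of `size₂`.
twoLevel : (ks : List (Word (suc b))) → Unique ks → 12 * length ks + 1 ≤ 2 ^ suc b → TwoLevel ks
twoLevel {b} ks u fits = build (power-above k)
  where
  open ≤-Reasoning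
  k = length ks
  build : ∃[ ℓ ] k < 2 ^ ℓ × 2 ^ ℓ ≤ 2 * k + 1 → TwoLevel ks
  build (ℓ , k< , ≤2k+1) = build′ (few-collisions ℓ ks ℓ≤)
    where
    ℓ≤ = 2^-cancel-≤ {ℓ} {suc b} (≤-trans ≤2k+1
        (≤-trans (+-monoˡ-≤ 1 (*-monoˡ-≤ k (s≤s (s≤s (z≤n {10}))))) fits))
    build′ : ∃[ a ] collisions a (shift ℓ) ks * 2 ^ ℓ ≤ 2 * (k * k) → TwoLevel ks
    build′ (a , few) = record
      { bits = ℓ ; bits≤ = ℓ≤ ; multiplier = a ; size₁ = ≤2k+1 ; size₂ = squares (2 ^ ℓ)
      -- Bucket `j` is wanted for every `j`, also beyond the table, so it is found as the last one
      -- of `upTo (suc j)`. Its squared size is at most `3 * k`, and `4 * (3 * k)` is the source of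
      -- the 12 in the hypothesis.
      ; level₂ = λ j → perfect (keys j) (≤-trans (+-monoˡ-≤ 1 (≤-trans (*-monoʳ-≤ 4 (≤-trans
          (∈⇒≤∑ (λ j → length (keys j) * length (keys j)) (∈-upTo⁺ (n<1+n j))) (squares (suc j))))
          (≤-reflexive (sym (*-assoc 4 3 k))))) fits) }
      where
      keys = bucket a (shift ℓ) ks
      coll≤ : ∀ c k n → k < n → c * n ≤ 2 * (k * k) → c ≤ 2 * k
      coll≤ c zero    (suc n) _   le = ≤-trans (m≤m*n c (suc n)) le
      coll≤ c k@(suc _) n     k<n le = *-cancelʳ-≤ c (2 * k) k (begin
        c * k        ≤⟨ *-monoʳ-≤ c (<⇒≤ k<n) ⟩
        c * n        ≤⟨ le ⟩
        2 * (k * k)  ≡⟨ *-assoc 2 k k ⟨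
        2 * k * k    ∎)
      squares : ∀ n → ∑ (upTo n) (λ j → length (keys j) * length (keys j)) ≤ 3 * k
      squares n = begin
        _                                ≤⟨ ∑-bucket² n a (shift ℓ) u ⟩
        collisions a (shift ℓ) ks + k    ≤⟨ +-monoˡ-≤ k (coll≤ _ k (2 ^ ℓ) k< few) ⟩
        2 * k + k                        ≡⟨ +-comm (2 * k) k ⟩
        3 * k                            ∎

-- Memory layout

-- With positions in `ℕ` rather than `Fin (length xs)`, addresses add up across `_++_` without
-- coercions.
data At {A : Set} : List A → ℕ → A → Set where
  here  : ∀ {x xs} → At (x ∷ xs) 0 x
  there : ∀ {x y xs i} → At xs i x → At (y ∷ xs) (suc i) x

At-++ˡ : ∀ {xs : List A} {ys i x} → At xs i x → At (xs ++ ys) i x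
At-++ˡ here      = here
At-++ˡ (there a) = there (At-++ˡ a)

At-++ʳ : ∀ (xs : List A) {ys i x} → At ys i x → At (xs ++ ys) (length xs + i) x
At-++ʳ []       a = a
At-++ʳ (_ ∷ xs) a = there (At-++ʳ xs a)

At⇒< : ∀ {xs : List A} {i x} → At xs i x → i < length xs
At⇒< here      = s≤s z≤n
At⇒< (there a) = s≤s (At⇒< a)

At-upTo : ∀ {n i} → i < n → At (upTo n) i i
At-upTo = go id
  where
  go : ∀ {A : Set} (f : ℕ → A) {n i} → i < n → At (applyUpTo f n) i (f i)
  go f {suc n} {zero}  _        = here
  go f {suc n} {suc i} (s≤s i<) = there (go (f ∘ suc) i<)

Holds : List A → ℕ → List A → Set
Holds mem o seg = ∀ {i x} → At seg i x → At mem (o + i) x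

Holds-++ˡ : ∀ {mem : List A} {o} xs {ys} → Holds mem o (xs ++ ys) → Holds mem o xs
Holds-++ˡ xs h = h ∘ At-++ˡ

Holds-++ʳ : ∀ {mem : List A} {o} xs {ys} → Holds mem o (xs ++ ys) → Holds mem (o + length xs) ys
Holds-++ʳ {mem = mem} {o} xs h {i} {x} a =
  subst (λ j → At mem j x) (sym (+-assoc o (length xs) i)) (h (At-++ʳ xs a))

-- A table of fixed-width records is followed by one variable-length block per record;
-- both may depend on the address p of the block.
module Layout {I A : Set} (width : ℕ) (rec blk : I → ℕ → List A)
              (length-rec : ∀ x p → length (rec x p) ≡ width) where

  records blocks : List I → ℕ → List A
  records []       p = []
  records (x ∷ xs) p = rec x p ++ records xs (p + length (blk x p))
  blocks  []       p = []
  blocks  (x ∷ xs) p = blk x p ++ blocks xs (p + length (blk x p))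

  layout : List I → ℕ → List A
  layout xs o = records xs p ++ blocks xs p
    where p = o + length xs * width

  length-records : ∀ xs p → length (records xs p) ≡ length xs * width
  length-records []       p = refl
  length-records (x ∷ xs) p =
    trans (length-++ (rec x p)) (cong₂ _+_ (length-rec x p) (length-records xs _))

  length-blocks : ∀ {f} xs p → (∀ x p → length (blk x p) ≤ f x) → length (blocks xs p) ≤ ∑ xs f
  length-blocks []       p bound = z≤n
  length-blocks (x ∷ xs) p bound =
    ≤-trans (≤-reflexive (length-++ (blk x p))) (+-mono-≤ (bound x p) (length-blocks xs _ bound))

  length-layout : ∀ {f} xs o → (∀ x p → length (blk x p) ≤ f x) →
                  length (layout xs o) ≤ length xs * width + ∑ xs f
  length-layout xs o bound = ≤-trans (≤-reflexive (length-++ (records xs _)))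
    (+-mono-≤ (≤-reflexive (length-records xs _)) (length-blocks xs _ bound))

  module _ {mem : List A} where

    entry : ∀ xs {o p i x} → Holds mem o (records xs p) → Holds mem p (blocks xs p) → At xs i x →
            ∃[ q ] Holds mem (o + i * width) (rec x q) × Holds mem q (blk x q)
    entry (x ∷ xs) {o} {p} hr hb here =
      p , subst (λ o → Holds mem o (rec x p)) (sym (+-identityʳ o)) (Holds-++ˡ (rec x p) hr)
        , Holds-++ˡ (blk x p) hb
    entry (y ∷ xs) {o} {p} {suc i} {x} hr hb (there a)
      with q , hr′ , hb′ ← entry xs (Holds-++ʳ (rec y p) hr) (Holds-++ʳ (blk y p) hb) a =
      q , subst (λ o → Holds mem o (rec x q))
            (trans (cong (λ w → o + w + i * width) (length-rec y p))
                (+-assoc o width (i * width))) hr′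
        , hb′

    layout-entry : ∀ xs {o i x} → Holds mem o (layout xs o) → At xs i x →
                   ∃[ q ] Holds mem (o + i * width) (rec x q) × Holds mem q (blk x q)
    layout-entry xs {o} h = entry xs (Holds-++ˡ (records xs _) h)
      (subst (λ p → Holds mem p (blocks xs (o + length xs * width)))
             (cong (o +_) (length-records xs _)) (Holds-++ʳ (records xs _) h))

-- An empty slot is filled with the letter `wrap 0`. This is harmless: the table stores the true
-- value of whatever letter it holds, so a query for `wrap 0` that lands there is answered
-- correctly.
slot : {ks : List (Word b)} → Perfect ks → ℕ → Word b
slot {ks = ks} perf i with filter
    (λ x → value (hash (Perfect.multiplier perf) (shift (Perfect.bits perf)) x) ℕ.≟ i) ks
... | []    = wrap 0
... | k ∷ _ = k

slot-hash : ∀ {ks : List (Word b)} (perf : Perfect ks) {c} → c ∈ ks →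
  slot perf (value (hash (Perfect.multiplier perf) (shift (Perfect.bits perf)) c)) ≡ c
slot-hash {ks = ks} perf {c} c∈
  with P? ← (λ x → value (hash (Perfect.multiplier perf) (shift (Perfect.bits perf)) x)
                   ℕ.≟ value (hash (Perfect.multiplier perf) (shift (Perfect.bits perf)) c))
  with filter P? ks | ∈-filter⁺ P? c∈ refl | (λ {k} → ∈-filter⁻ P? {k} {ks})
... | k ∷ _ | _ | sound with k∈ , eqn ← sound (here refl) =
  Perfect.injective perf k∈ c∈ (value-injective eqn)

-- The third word of a slot is padding. With records of three words on both levels, the same
-- `probeCmd` serves both.
module Level₂ {ks : List (Word b)} (perf : Perfect ks) (val : Word b → Word b) where
  open Layout {ℕ} 3 (λ i _ → slot perf i ∷ val (slot perf i) ∷ wrap 0 ∷ []) (λ _ _ → [])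
      (λ _ _ → refl) public

  table : ℕ → List (Word b)
  table = layout (upTo (2 ^ Perfect.bits perf))

  length-table : ∀ o → length (table o) ≤ 12 * (length ks * length ks) + 3
  length-table o = begin
    length (table o)                             ≤⟨ length-layout R o (λ _ _ → z≤n) ⟩
    length R * 3 + ∑ R (λ _ → 0)
      ≡⟨ cong₂ (λ m n → m * 3 + n) (length-upTo (2 ^ Perfect.bits perf))
           (trans (∑-const R 0) (*-zeroʳ (length R))) ⟩
    2 ^ Perfect.bits perf * 3 + 0                ≤⟨ +-monoˡ-≤ 0 (*-monoˡ-≤ 3 (Perfect.size≤ perf)) ⟩
    (4 * (length ks * length ks) + 1) * 3 + 0    ≡⟨ lemma (length ks * length ks) ⟩
    12 * (length ks * length ks) + 3             ∎
    where
    open ≤-Reasoning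
    R = upTo (2 ^ Perfect.bits perf)
    lemma : ∀ m → (4 * m + 1) * 3 + 0 ≡ 12 * m + 3
    lemma = solve-∀

record Triple {A : Set} (mem : List A) (p : ℕ) (x y z : A) : Set where
  constructor triple
  field
    first  : At mem p x
    second : At mem (p + 1) y
    third  : At mem (p + 1 + 1) z

triple-at : ∀ {mem : List A} {p x y z zs} → Holds mem p (x ∷ y ∷ z ∷ zs) → Triple mem p x y z
triple-at {mem = mem} {p} {x} {z = z} h = triple
  (subst (λ q → At mem q x) (+-identityʳ p) (h here)) (h (there here))
  (subst (λ q → At mem q z) (sym (+-assoc p 1 1)) (h (there (there here))))

record Entry (mem : List (Word b)) (q : ℕ) (c v : Word b) : Set where
  field
    key val : Word b
    key-at  : At mem q key
    val-at  : At mem (q + 1) val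
    hit     : key ≡ c → val ≡ v
    miss    : key ≢ c → v ≡ wrap 0

probe : Word b → Word b → Word b → Word b → ℕ
probe a s t c = value t + value (hash a s c) * 3

-- A first-level record is again a triple of multiplier, shift and table address, like the one from
-- which the lookup starts. A lookup is therefore two equal probes and a comparison of keys.
record Lookup (mem : List (Word b)) (a s t c v : Word b) : Set where
  field
    a₂ s₂ t₂ : Word b
    header   : Triple mem (probe a s t c) a₂ s₂ t₂
    entry    : Entry mem (probe a₂ s₂ t₂ c) c v

module Dictionary {ks : List (Word b)} (two : TwoLevel ks) (val : Word b → Word b) where
  open TwoLevel two

  private
    R : List ℕ
    R = upTo (2 ^ bits)

  open Layout {ℕ} 3
    (λ j p → Perfect.multiplier (level₂ j) ∷ shift (Perfect.bits (level₂ j)) ∷ wrap p ∷ [])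
    (λ j → Level₂.table (level₂ j) val) (λ _ _ → refl) public

  dictionary : ℕ → List (Word b)
  dictionary = layout R

  length-dictionary : ∀ o → length (dictionary o) ≤ 48 * length ks + 6
  length-dictionary o = begin
    length (dictionary o)
      ≤⟨ length-layout R o (λ j → Level₂.length-table (level₂ j) val) ⟩
    length R * 3 + ∑ R (λ j → 12 * k² j + 3)
      ≡⟨ cong (length R * 3 +_) (trans (∑-distrib-+ R (λ j → 12 * k² j) (λ _ → 3))
           (cong₂ _+_ (sym (∑-distribˡ-* 12 R k²)) (∑-const R 3))) ⟩
    length R * 3 + (12 * ∑ R k² + length R * 3)
      ≡⟨ cong (λ n → n * 3 + (12 * ∑ R k² + n * 3)) (length-upTo (2 ^ bits)) ⟩
    2 ^ bits * 3 + (12 * ∑ R k² + 2 ^ bits * 3)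
      ≤⟨ +-mono-≤ (*-monoˡ-≤ 3 size₁) (+-mono-≤ (*-monoʳ-≤ 12 size₂) (*-monoˡ-≤ 3 size₁)) ⟩
    (2 * length ks + 1) * 3 + (12 * (3 * length ks) + (2 * length ks + 1) * 3)
      ≡⟨ lemma (length ks) ⟩
    48 * length ks + 6 ∎
    where
    open ≤-Reasoning
    k² : ℕ → ℕ
    k² j = length (keys j) * length (keys j)
    lemma : ∀ k → (2 * k + 1) * 3 + (12 * (3 * k) + (2 * k + 1) * 3) ≡ 48 * k + 6
    lemma = solve-∀

  module _ {mem : List (Word b)} (mem≤ : length mem ≤ 2 ^ b) where

    -- An occupied cell at or beyond `p` puts `p` below the memory size, so `wrap` loses nothing.
    address : ∀ {p q w} → p ≤ q → At mem q w → value (wrap {b} p) ≡ p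
    address p≤q a = value-wrap-< {b} (≤-trans (s≤s p≤q) (≤-trans (At⇒< a) mem≤))

    -- Even a dictionary without keys has `2 ^ bits ≥ 1` first-level records, so its address is an
    -- occupied cell.
    lookup-header : ∀ {o} → Holds mem o (dictionary o) → value (wrap {b} o) ≡ o
    lookup-header {o} h with layout-entry R {i = 0} h (At-upTo (m^n>0 2 bits))
    ... | q , hr , _ = address (≤-trans (m≤m+n o 0) (m≤m+n (o + 0) 0)) (hr here)

    -- Only letters with a nonzero value have to be keys. Any other letter either meets itself in
    -- its slot, with its true value beside it, or meets a different key and is reported as
    -- `wrap 0`.
    lookup-correct : ∀ {o} → Holds mem o (dictionary o) → (∀ c → val c ≢ wrap 0 → c ∈ ks) →
                     ∀ c → Lookup mem multiplier (shift bits) (wrap o) c (val c)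
    lookup-correct {o} h complete c = found
      (layout-entry R {i = j} h (At-upTo (hash<2^ bits≤ multiplier c)))
      where
      j : ℕ
      j = value (hash multiplier (shift bits) c)
      module P = Perfect (level₂ j)
      i : ℕ
      i = value (hash P.multiplier (shift P.bits) c)
      k : Word b
      k = slot (level₂ j) i
      miss : k ≢ c → val c ≡ wrap 0
      miss k≢c with val c ≟ wrap 0
      ... | yes v≡0 = v≡0
      ... | no  v≢0 = contradiction (slot-hash (level₂ j)
        (∈-filter⁺ (λ x → value (hash multiplier (shift bits) x) ℕ.≟ j) (complete c v≢0) refl)) k≢c
      found : (∃[ q ] Holds mem (o + j * 3) (P.multiplier ∷ shift P.bits ∷ wrap q ∷ [])
                    × Holds mem q (Level₂.table (level₂ j) val q)) →
              Lookup mem multiplier (shift bits) (wrap o) c (val c)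
      found (q , hr , hb) = found₂ (Level₂.layout-entry (level₂ j) val
          (upTo (2 ^ P.bits)) {i = i} hb
                                      (At-upTo (hash<2^ P.bits≤ P.multiplier c)))
        where
        found₂ : (∃[ r ] Holds mem (q + i * 3) (k ∷ val k ∷ wrap 0 ∷ []) × Holds mem r []) →
                 Lookup mem multiplier (shift bits) (wrap o) c (val c)
        found₂ (_ , hr₂ , _) = record
          { a₂ = P.multiplier ; s₂ = shift P.bits ; t₂ = wrap q
          ; header = subst (λ o → Triple mem (o + j * 3) P.multiplier (shift P.bits) (wrap q))
                       (sym (lookup-header h)) (triple-at hr)
          ; entry  = subst (λ q → Entry mem (q + i * 3) c (val c)) (sym q≡) (record
              { key = k ; val = val k ; key-at = Triple.first kv ; val-at = Triple.second kv
              ; hit = cong val ; miss = miss })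
          }
          where
          kv : Triple mem (q + i * 3) k (val k) (wrap 0)
          kv = triple-at hr₂
          q≡ : value (wrap {b} q) ≡ q
          q≡ = address (m≤m+n q (i * 3)) (Triple.first kv)

-- Heavy patterns

∑-tabulate : ∀ n (f : Fin n → A) g → ∑ (tabulate f) g ≡ ∑ (allFin n) (g ∘ f)
∑-tabulate zero    f g = refl
∑-tabulate (suc n) f g = cong (g (f zero) +_)
  (trans (∑-tabulate n (f ∘ suc) g) (sym (∑-tabulate n suc (g ∘ f))))

rank : ∀ {n} {Q : Fin n → Set} → Decidable Q → Fin n → ℕ
rank Q? zero    = 0
rank Q? (suc i) = 𝟙 (Q? zero) + rank (Q? ∘ suc) i

rank-mono : ∀ {n} {Q R : Fin n → Set} (Q? : Decidable Q) (R? : Decidable R) →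
            (∀ {i} → Q i → R i) → ∀ i → rank Q? i ≤ rank R? i
rank-mono Q? R? Q⊆R zero    = z≤n
rank-mono Q? R? Q⊆R (suc i) =
  +-mono-≤ (𝟙-mono (Q? zero) (R? zero) Q⊆R) (rank-mono (Q? ∘ suc) (R? ∘ suc) Q⊆R i)

rank<count : ∀ {n} {Q : Fin n → Set} (Q? : Decidable Q) → ∀ {i} → Q i →
    rank Q? i < ∑ (allFin n) (𝟙 ∘ Q?)
rank<count {suc n} Q? {zero}  q = m≤n⇒m≤n+o _ (≤-reflexive (sym (𝟙-yes (Q? zero) q)))
rank<count {suc n} Q? {suc i} q = subst (rank Q? (suc i) <_)
  (cong (𝟙 (Q? zero) +_) (sym (∑-tabulate n suc (𝟙 ∘ Q?))))
  (+-monoʳ-< (𝟙 (Q? zero)) (rank<count (Q? ∘ suc) q))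

select : ∀ {n} {Q : Fin n → Set} (Q? : Decidable Q) → ∀ {k} → k < ∑ (allFin n) (𝟙 ∘ Q?) →
         ∃[ i ] Q i × rank Q? i ≡ k
select {suc n} Q? {k} k< = go k (Q? zero) refl
  (subst (λ m → k < 𝟙 (Q? zero) + m) (∑-tabulate n suc (𝟙 ∘ Q?)) k<)
  where
  go : ∀ k (d : Dec _) → Q? zero ≡ d → k < 𝟙 d + ∑ (allFin n) (𝟙 ∘ Q? ∘ suc) →
       ∃[ i ] _ × rank Q? i ≡ k
  go zero    (yes q) _  _        = zero , q , refl
  go (suc k) (yes _) d≡ (s≤s k<) with i , q , r ← select (Q? ∘ suc) k< =
    suc i , q , trans (cong (λ d → 𝟙 d + rank (Q? ∘ suc) i) d≡) (cong suc r)
  go k       (no _)  d≡ k<       with i , q , r ← select (Q? ∘ suc) k< =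
    suc i , q , trans (cong (λ d → 𝟙 d + rank (Q? ∘ suc) i) d≡) r

_⊑_ : List A → List A → Set
_⊑_ = Prefix _≡_

⊑-trans : ∀ {xs ys zs : List A} → xs ⊑ ys → ys ⊑ zs → xs ⊑ zs
⊑-trans = Prefix.trans trans

⊑-refl : ∀ (xs : List A) → xs ⊑ xs
⊑-refl []       = []
⊑-refl (x ∷ xs) = refl ∷ ⊑-refl xs

⊑-comparable : ∀ {xs ys zs : List A} → xs ⊑ zs → ys ⊑ zs → length xs ≤ length ys → xs ⊑ ys
⊑-comparable []         _          _        = []
⊑-comparable (refl ∷ p) (refl ∷ q) (s≤s le) = refl ∷ ⊑-comparable p q le

⊑∧length≥⇒≡ : ∀ {xs ys : List A} → xs ⊑ ys → length ys ≤ length xs → xs ≡ ys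
⊑∧length≥⇒≡ {ys = []}    []         _        = refl
⊑∧length≥⇒≡ {ys = _ ∷ _} (refl ∷ p) (s≤s le) = cong (_ ∷_) (⊑∧length≥⇒≡ p le)

⊑⇒take : ∀ {xs ys : List A} → xs ⊑ ys → take (length xs) ys ≡ xs
⊑⇒take []         = refl
⊑⇒take (refl ∷ p) = cong (_ ∷_) (⊑⇒take p)

butLast : List A → List A
butLast []           = []
butLast (x ∷ [])     = []
butLast (x ∷ y ∷ xs) = x ∷ butLast (y ∷ xs)

lastOr : A → List A → A
lastOr d []       = d
lastOr d (x ∷ xs) = lastOr x xs

butLast-∷ʳ : ∀ (xs : List A) x → butLast (xs ∷ʳ x) ≡ xs
butLast-∷ʳ []           x = refl
butLast-∷ʳ (y ∷ [])     x = refl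
butLast-∷ʳ (y ∷ z ∷ xs) x = cong (y ∷_) (butLast-∷ʳ (z ∷ xs) x)

lastOr-∷ʳ : ∀ d (xs : List A) x → lastOr d (xs ∷ʳ x) ≡ x
lastOr-∷ʳ d []       x = refl
lastOr-∷ʳ d (y ∷ xs) x = lastOr-∷ʳ y xs x

module Heavy (T : String b) where

  private
    N = length T

  Heavy : String b → Set
  Heavy P = length P < length (Occ T P)

  -- Position i is the node of P if occurrence number |P| of P, counting from 0, is at i.
  record Node (P : String b) (i : Fin N) : Set where
    constructor node
    field
      occurs : OccursAt T P i
      rank≡  : rank (occursAt? T P) i ≡ length P

  node? : ∀ P → Decidable (Node P)
  node? P i = map′ (λ (o , r) → node o r) (λ (node o r) → o , r)
    (occursAt? T P i ×-dec (rank (occursAt? T P) i ℕ.≟ length P))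

  heavy⇒node : ∀ {P} → Heavy P → ∃[ i ] Node P i
  heavy⇒node {P} heavy
    with i , o , r ← select (occursAt? T P) (subst (length P <_) (length-filter-∑ (occursAt? T P) (allFin N)) heavy) =
    i , node o r

  node⇒heavy : ∀ {P i} → Node P i → Heavy P
  node⇒heavy {P} {i} (node occurs r≡) =
      subst₂ _<_ r≡ (sym (length-filter-∑ (occursAt? T P) (allFin N)))
    (rank<count (occursAt? T P) {i} occurs)

  -- Passing to a prefix shortens the pattern and can only add occurrences.
  heavy-⊑ : ∀ {P P′} → P ⊑ P′ → Heavy P′ → Heavy P
  heavy-⊑ {P} {P′} P⊑P′ heavy = begin-strict
    length P                               ≤⟨ Prefix.length-mono P⊑P′ ⟩
    length P′                              <⟨ heavy ⟩
    length (Occ T P′)                      ≡⟨ length-filter-∑ (occursAt? T P′) (allFin N) ⟩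
    ∑ (allFin N) (𝟙 ∘ occursAt? T P′)
      ≤⟨ ∑-mono (allFin N) (λ i → 𝟙-mono (occursAt? T P′ i) (occursAt? T P i) (⊑-trans P⊑P′)) ⟩
    ∑ (allFin N) (𝟙 ∘ occursAt? T P)       ≡⟨ length-filter-∑ (occursAt? T P) (allFin N) ⟨
    length (Occ T P)                       ∎
    where open ≤-Reasoning

  node-unique : ∀ {P P′ i} → Node P i → Node P′ i → P ≡ P′
  node-unique {P} {P′} ν ν′ =
    [ (λ le → ordered ν ν′ le) , (λ le → sym (ordered ν′ ν le)) ]′ (≤-total (length P) (length P′))
    where
    ordered : ∀ {P P′ i} → Node P i → Node P′ i → length P ≤ length P′ → P ≡ P′
    ordered {P} {P′} {i} (node occurs r≡) (node occurs′ r′≡) le =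
        ⊑∧length≥⇒≡ P⊑P′ (subst₂ _≤_ r′≡ r≡
      (rank-mono (occursAt? T P′) (occursAt? T P) (⊑-trans P⊑P′) i))
      where
      P⊑P′ : P ⊑ P′
      P⊑P′ = ⊑-comparable occurs occurs′ le

  nodeOf : String b → Maybe (Fin N)
  nodeOf P with any? (node? P)
  ... | yes (i , _) = just i
  ... | no  _       = nothing

  nodeOf-just : ∀ {P i} → nodeOf P ≡ just i → Node P i
  nodeOf-just {P} eqn with any? (node? P)
  nodeOf-just refl | yes (i , ν) = ν

  nodeOf-nothing : ∀ {P} → nodeOf P ≡ nothing → ¬ Heavy P
  nodeOf-nothing {P} eqn heavy with any? (node? P)
  nodeOf-nothing ()  heavy | yes _
  nodeOf-nothing _   heavy | no ¬ν = ¬ν (heavy⇒node heavy)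

  -- This lets the descent stop at the first missing node: every extension is missing too.
  nodeOf-⊑ : ∀ {P P′} → P ⊑ P′ → nodeOf P ≡ nothing → nodeOf P′ ≡ nothing
  nodeOf-⊑ {P} {P′} P⊑P′ eqn with nodeOf P′ in eqn′
  ... | nothing = refl
  ... | just i  = contradiction (heavy-⊑ P⊑P′ (node⇒heavy (nodeOf-just eqn′))) (nodeOf-nothing eqn)

  private
    prefixAt : Fin N → ℕ → String b
    prefixAt i m = take m (drop (toℕ i) T)

    length-prefixAt : ∀ i m → length (prefixAt i m) ≤ N
    length-prefixAt i m = ≤-trans (≤-reflexive (length-take m _))
      (≤-trans (m⊓n≤n m _) (≤-trans (≤-reflexive (length-drop (toℕ i) T)) (m∸n≤m N (toℕ i))))

    search : ∀ i → Dec (∃[ m ] Node (prefixAt i (toℕ {suc N} m)) i)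
    search i = any? (λ m → node? (prefixAt i (toℕ m)) i)

  -- Inverse to `nodeOf`: a pattern occurring at `i` is determined by its length, so a search over
  -- lengths recovers it. A position that is no node gets `[]` as a filler, since every position has
  -- a record in the image.
  patternAt : Fin N → String b
  patternAt i with search i
  ... | yes (m , _) = prefixAt i (toℕ m)
  ... | no  _       = []

  length-patternAt : ∀ i → length (patternAt i) ≤ N
  length-patternAt i with search i
  ... | yes (m , _) = length-prefixAt i (toℕ m)
  ... | no  _       = z≤n

  patternAt-node : ∀ {P i} → Node P i → patternAt i ≡ P
  patternAt-node {P} {i} ν with search i
  ... | yes (m , ν′) = node-unique ν′ ν
  ... | no  ¬ν       = contradiction (fromℕ< |P|< , subst (λ P → Node P i) (sym P≡) ν) ¬ν
    where
    |P|< : length P < suc N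
    |P|< = s≤s (≤-trans (Prefix.length-mono (Node.occurs ν))
      (≤-trans (≤-reflexive (length-drop (toℕ i) T)) (m∸n≤m N (toℕ i))))
    P≡ : prefixAt i (toℕ (fromℕ< |P|<)) ≡ P
    P≡ = trans (cong (prefixAt i) (toℕ-fromℕ< |P|<)) (⊑⇒take (Node.occurs ν))

  private
    child? : ∀ i j → Dec (nodeOf (butLast (patternAt j)) ≡ just i)
    child? i j = Maybe.≡-dec _≟-Fin_ (nodeOf (butLast (patternAt j))) (just i)

    label : Fin N → Word b
    label j = lastOr (wrap 0) (patternAt j)

  -- As `butLast []` is `[]`, the root and the filler positions may give the root a spurious letter
  -- `wrap 0`. This is harmless, because children are stored according to `pointer` and not
  -- according to this list. Removing duplicates provides the distinct keys that hashing asks for.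
  edges : Fin N → List (Word b)
  edges i = deduplicate _≟_ (map label (filter (child? i) (allFin N)))

  edges-unique : ∀ i → Unique (edges i)
  edges-unique i = deduplicate-! _≟_ (map label (filter (child? i) (allFin N)))

  edges-complete : ∀ {P c i j} → nodeOf P ≡ just i → nodeOf (P ∷ʳ c) ≡ just j → c ∈ edges i
  edges-complete {P} {c} {i} {j} P≡ Pc≡ = ∈-deduplicate⁺ _≟_
    (subst (_∈ map label (filter (child? i) (allFin N)))
      (trans (cong (lastOr (wrap 0)) pattern≡) (lastOr-∷ʳ (wrap 0) P c))
      (∈-map⁺ label (∈-filter⁺ (child? i) (∈-allFin j)
        (trans (cong nodeOf (trans (cong butLast pattern≡) (butLast-∷ʳ P c))) P≡))))
    where
    pattern≡ : patternAt j ≡ P ∷ʳ c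
    pattern≡ = patternAt-node (nodeOf-just Pc≡)

  -- Counted from the child's side: each position `j` has at most one parent `i`.
  ∑-edges : ∑ (allFin N) (length ∘ edges) ≤ N
  ∑-edges = begin
    ∑ V (length ∘ edges)
      ≤⟨ ∑-mono V (λ i → ≤-trans (length-deduplicate _≟_ (map label (filter (child? i) V)))
           (≤-reflexive (trans (length-map label (filter (child? i) V))
               (length-filter-∑ (child? i) V)))) ⟩
    ∑ V (λ i → ∑ V (λ j → 𝟙 (child? i j)))
      ≡⟨ ∑-swap V V (λ i j → 𝟙 (child? i j)) ⟩
    ∑ V (λ j → ∑ V (λ i → 𝟙 (child? i j)))
      ≤⟨ ∑-mono V (λ j → ∑-𝟙≤1 (λ i → child? i j) (allFin⁺ N)
           (λ _ _ p q → Maybe.just-injective (trans (sym p) q))) ⟩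
    ∑ V (λ _ → 1)
      ≡⟨ trans (∑-const V 1) (trans (*-identityʳ _) (length-tabulate {n = N} id)) ⟩
    N ∎
    where
    open ≤-Reasoning
    V = allFin N

-- The memory image

At-allFin : ∀ {n} (i : Fin n) → At (allFin n) (toℕ i) i
At-allFin = go id
  where
  go : ∀ {n} (f : Fin n → A) i → At (tabulate f) (toℕ i) (f i)
  go f zero    = here
  go f (suc i) = there (go (f ∘ suc) i)

record NodeAt (mem : List (Word b)) (p : Word b) (ans : List (Word b)) (child : Word b → Word b) : Set where
  field
    a s t size start : Word b
    header   : Triple mem (value p) a s t
    size-at  : At mem (value p + 3) size
    start-at : At mem (value p + 3 + 1) start
    size≡    : value size ≡ length ans
    ans-at   : Holds mem (value start) ans
    lookups  : ∀ c → Lookup mem a s t c (child c)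

node-at-record : ∀ {mem : List (Word b)} {q p d pointer a s} {ans : List (Word b)} {child} →
  Holds mem q (a ∷ s ∷ wrap d ∷ wrap (length ans) ∷ wrap p ∷ []) → Holds mem p ans →
  d ≡ p + length ans → d < 2 ^ b → (∀ c → Lookup mem a s (wrap d) c (child c)) →
  value pointer ≡ q → NodeAt mem pointer ans child
node-at-record {b} {mem} {p = p} {pointer = pointer} {a} {s} {ans} h ans-at refl d< lookups refl =
    record
  { a = a ; s = s ; t = wrap (p + length ans) ; size = wrap (length ans) ; start = wrap p
  ; header   = triple-at h
  ; size-at  = h (there (there (there here)))
  ; start-at = subst (λ q → At mem q (wrap p)) (sym (+-assoc (value pointer) 3 1))
      (h (there (there (there (there here)))))
  ; size≡    = value-wrap-< {b} (≤-<-trans (m≤n+m (length ans) p) d<)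
  ; ans-at   = subst (λ q → Holds mem q ans)
      (sym (value-wrap-< {b} (≤-<-trans (m≤m+n p (length ans)) d<))) ans-at
  ; lookups  = lookups
  }

module Image (T : String (suc b)) (D : List (Word (suc b)))
             (answer : String (suc b) → List (Word (suc b)))
             (T-fits : 12 * length T + 1 ≤ 2 ^ suc b) where
  open Heavy T

  private
    N = length T

  base : ℕ
  base = 2 + length D

  address : Fin N → Word (suc b)
  address i = wrap (base + toℕ i * 5)

  -- Node addresses are at least base, so 0 can represent the absence of a node.
  pointer : String (suc b) → Word (suc b)
  pointer P = maybe address (wrap 0) (nodeOf P)

  ans : Fin N → List (Word (suc b))
  ans i = answer (patternAt i)

  child : Fin N → Word (suc b) → Word (suc b)
  child i c = pointer (patternAt i ∷ʳ c)

  two : ∀ i → TwoLevel (edges i)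
  two i = twoLevel (edges i) (edges-unique i)
    (≤-trans (+-monoˡ-≤ 1 (*-monoʳ-≤ 12
        (≤-trans (∈⇒≤∑ (length ∘ edges) (∈-allFin i)) ∑-edges))) T-fits)

  module Dict i = Dictionary (two i) (child i)

  open Layout {Fin N} 5
    (λ i p → TwoLevel.multiplier (two i) ∷ shift (TwoLevel.bits (two i)) ∷ wrap
        (p + length (ans i)) ∷
             wrap (length (ans i)) ∷ wrap p ∷ [])
    (λ i p → ans i ++ Dict.dictionary i (p + length (ans i)))
    (λ _ _ → refl)

  -- Word 0 is the mode flag, 1 for an image with a trie; word 1 is the root pointer, and `D` starts
  -- at address 2.
  image : List (Word (suc b))
  image = wrap 1 ∷ pointer [] ∷ D ++ layout (allFin N) base

  D-at : ∀ {i x} → At D i x → At image (2 + i) x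
  D-at a = there (there (At-++ˡ a))

  -- Per position, 59 is 5 words of record, 48 for an edge (there are at most `N` edges in all) and
  -- 6 for the fixed part of a dictionary.
  length-image : ∀ W → (∀ P → length P ≤ N → length (answer P) ≤ W) →
                 length image ≤ 2 + length D + (59 * N + W * N)
  length-image W ans≤ = begin
    length image
      ≡⟨ cong (2 +_) (length-++ D) ⟩
    2 + (length D + length (layout V base))
      ≤⟨ +-monoʳ-≤ (2 + length D) (length-layout V base block≤) ⟩
    2 + length D + (length V * 5 + ∑ V (λ i → W + (48 * length (edges i) + 6)))
      ≡⟨ cong₂ (λ m n → 2 + length D + (m * 5 + n)) |V| split ⟩
    2 + length D + (N * 5 + (N * W + (48 * ∑ V (length ∘ edges) + N * 6)))
      ≤⟨ +-monoʳ-≤ (2 + length D) (+-monoʳ-≤ (N * 5) (+-monoʳ-≤ (N * W)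
           (+-monoˡ-≤ (N * 6) (*-monoʳ-≤ 48 ∑-edges)))) ⟩
    2 + length D + (N * 5 + (N * W + (48 * N + N * 6)))
      ≡⟨ cong (2 + length D +_) (lemma N W) ⟩
    2 + length D + (59 * N + W * N) ∎
    where
    open ≤-Reasoning
    V = allFin N
    |V| : length V ≡ N
    |V| = length-tabulate {n = N} id
    block≤ : ∀ i p → length (ans i ++ Dict.dictionary i (p + length (ans i))) ≤ W +
        (48 * length (edges i) + 6)
    block≤ i p = ≤-trans (≤-reflexive (length-++ (ans i)))
      (+-mono-≤ (ans≤ (patternAt i) (length-patternAt i)) (Dict.length-dictionary i _))
    split : ∑ V (λ i → W + (48 * length (edges i) + 6)) ≡ N * W +
        (48 * ∑ V (length ∘ edges) + N * 6)
    split = trans (∑-distrib-+ V (λ _ → W) (λ i → 48 * length (edges i) + 6)) (cong₂ _+_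
      (trans (∑-const V W) (cong (_* W) |V|))
      (trans (∑-distrib-+ V (λ i → 48 * length (edges i)) (λ _ → 6))
             (cong₂ _+_ (sym (∑-distribˡ-* 48 V (length ∘ edges)))
                 (trans (∑-const V 6) (cong (_* 6) |V|)))))
    lemma : ∀ n w → n * 5 + (n * w + (48 * n + n * 6)) ≡ 59 * n + w * n
    lemma = solve-∀

  pointer-nothing : ∀ {P} → nodeOf P ≡ nothing → pointer P ≡ wrap 0
  pointer-nothing = cong (maybe {B = λ _ → Word (suc b)} address (wrap 0))

  edges-complete′ : ∀ {P i} → nodeOf P ≡ just i → ∀ c → pointer (P ∷ʳ c) ≢ wrap 0 → c ∈ edges i
  edges-complete′ {P} {i} P≡ c ≢0 = go (nodeOf (P ∷ʳ c)) refl
    where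
    go : ∀ m → nodeOf (P ∷ʳ c) ≡ m → c ∈ edges i
    go (just j) Pc≡ = edges-complete P≡ Pc≡
    go nothing  Pc≡ = contradiction (pointer-nothing Pc≡) ≢0

  module _ (image≤ : length image ≤ 2 ^ suc b) where

    private
      layout-at : Holds image base (layout (allFin N) base)
      layout-at a = there (there (At-++ʳ D a))

    module _ {P i} (P≡ : nodeOf P ≡ just i) where

      private
        P′≡ : patternAt i ≡ P
        P′≡ = patternAt-node (nodeOf-just P≡)

        q : ℕ
        q = base + toℕ i * 5

      value-pointer : ∀ {w} → At image q w → value (pointer P) ≡ q
      value-pointer a = trans (cong (λ m →
          value (maybe {B = λ _ → Word (suc b)} address (wrap 0) m)) P≡)
        (value-wrap-< {suc b} (≤-trans (At⇒< a) image≤))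

      private
        located : ∀ p →
          let d = p + length (ans i) in
          Holds image q (TwoLevel.multiplier (two i) ∷ shift (TwoLevel.bits (two i)) ∷ wrap d ∷
                         wrap (length (ans i)) ∷ wrap p ∷ []) →
          Holds image p (ans i ++ Dict.dictionary i d) →
          NodeAt image (pointer P) (ans i) (child i)
        located p hr hb = node-at-record hr (Holds-++ˡ (ans i) hb) refl
          (subst (_< 2 ^ suc b) (Dict.lookup-header i image≤ dict-at)
              (value<2^ (wrap {suc b} (p + length (ans i)))))
          (Dict.lookup-correct i image≤ dict-at complete)
          (value-pointer (Triple.first (triple-at hr)))
          where
          dict-at : Holds image (p + length (ans i)) (Dict.dictionary i (p + length (ans i)))
          dict-at = Holds-++ʳ (ans i) hb
          complete : ∀ c → child i c ≢ wrap 0 → c ∈ edges i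
          complete c ≢0 = edges-complete′ P≡ c (subst (λ P → pointer (P ∷ʳ c) ≢ wrap 0) P′≡ ≢0)

      pointer≢0 : value (pointer P) ≢ 0
      pointer≢0 0≡ = 0≢1+n (trans (sym 0≡)
        (let p , hr , _ = layout-entry (allFin N) layout-at (At-allFin i) in value-pointer (Triple.first (triple-at hr))))

      node-at : NodeAt image (pointer P) (answer P) (λ c → pointer (P ∷ʳ c))
      node-at = subst (λ P′ → NodeAt image (pointer P) (answer P′) (λ c → pointer (P′ ∷ʳ c))) P′≡
        (let p , hr , hb = layout-entry (allFin N) layout-at (At-allFin i) in located p hr hb)

-- The query program

value-0 : value (wrap {b} 0) ≡ 0
value-0 {b} = value-wrap-< {b} (m^n>0 2 b)

value-add : (x y : Word b) → value x + value y < 2 ^ b → value (⟦ add ⟧ x y) ≡ value x + value y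
value-add {b} x y = value-wrap-< {b}

value-mul : (x y : Word b) → value x * value y < 2 ^ b → value (⟦ mul ⟧ x y) ≡ value x * value y
value-mul {b} x y = value-wrap-< {b}

wrap-value : (x : Word b) → wrap (value x) ≡ x
wrap-value {b} x = value-injective (value-wrap-< {b} (value<2^ x))

eq-yes : (x : Word b) → ⟦ eq ⟧ x x ≡ wrap 1
eq-yes x with value x ≡ᵇ value x in e
... | true  = refl
... | false with () ← subst T e (≡⇒≡ᵇ (value x) (value x) refl)

eq-no : (x y : Word b) → x ≢ y → ⟦ eq ⟧ x y ≡ wrap 0
eq-no x y x≢y with value x ≡ᵇ value y in e
... | true  = contradiction (value-injective (≡ᵇ⇒≡ (value x) (value y) (subst T (sym e) _))) x≢y
... | false = refl

lt-yes : (x y : Word b) → value x < value y → ⟦ lt ⟧ x y ≡ wrap 1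
lt-yes x y x<y with value x <ᵇ value y in e
... | true  = refl
... | false with () ← subst T e (<⇒<ᵇ x<y)

lt-no : (x y : Word b) → ¬ value x < value y → ⟦ lt ⟧ x y ≡ wrap 0
lt-no x y x≮y with value x <ᵇ value y in e
... | true  = contradiction (<ᵇ⇒< (value x) (value y) (subst T (sym e) _)) x≮y
... | false = refl

mul-0ˡ : (x : Word b) → ⟦ mul ⟧ (wrap 0) x ≡ wrap 0
mul-0ˡ {b} x = cong (λ m → wrap (m * value x)) (value-0 {b})

mul-0ʳ : (x : Word b) → ⟦ mul ⟧ x (wrap 0) ≡ wrap 0
mul-0ʳ {b} x = cong wrap (trans (cong (value x *_) (value-0 {b})) (*-zeroʳ (value x)))

mul-1ˡ : 1 < 2 ^ b → (x : Word b) → ⟦ mul ⟧ (wrap 1) x ≡ x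
mul-1ˡ {b} 1< x = trans (cong wrap
    (trans (cong (_* value x) (value-wrap-< {b} 1<)) (*-identityˡ (value x)))) (wrap-value x)

At-index : ∀ {xs : List A} {i x} → At xs i x → Σ[ j ∈ Fin (length xs) ] toℕ j ≡ i × lookup xs j ≡ x
At-index here      = zero , refl , refl
At-index (there a) = let j , j≡ , x≡ = At-index a in suc j , cong suc j≡ , x≡

At-lookup : ∀ (xs : List A) i → At xs (toℕ i) (lookup xs i)
At-lookup (x ∷ xs) zero    = here
At-lookup (x ∷ xs) (suc i) = there (At-lookup xs i)

-- The registers of Q̂; the remaining ones are those of Q.
module _ {k : ℕ} where
  one pos len cur chr acc tmp three guard : Fin (9 + k)
  one   = zero
  pos   = suc zero
  len   = suc (suc zero)
  cur   = suc (suc (suc zero))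
  chr   = suc (suc (suc (suc zero)))
  acc   = suc (suc (suc (suc (suc zero))))
  tmp   = suc (suc (suc (suc (suc (suc zero)))))
  three = suc (suc (suc (suc (suc (suc (suc zero))))))
  guard = suc (suc (suc (suc (suc (suc (suc (suc zero)))))))

  own : Fin k → Fin (9 + k)
  own = 9 ↑ʳ_

  -- Q expects its data structure at address 0, Q̂ stores it at address 2.
  liftInstr : Instr k → Cmd (9 + k)
  liftInstr (const r c)     = instr (const (own r) c)
  liftInstr (apply r o x y) = instr (apply (own r) o (own x) (own y))
  liftInstr (patLen r)      = instr (patLen (own r))
  liftInstr (readPat r x)   = instr (readPat (own r) (own x))
  liftInstr (readData r x)  = instr (const tmp 2) ⨾ instr (apply tmp add tmp (own x)) ⨾
      instr (readData (own r) tmp)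
  liftInstr (readWork r x)  = instr (readWork (own r) (own x))
  liftInstr (writeWork x y) = instr (writeWork (own x) (own y))
  liftInstr (emit x)        = instr (emit (own x))

  liftCmd : Cmd k → Cmd (9 + k)
  liftCmd skip         = skip
  liftCmd (instr i)    = liftInstr i
  liftCmd (p ⨾ q)      = liftCmd p ⨾ liftCmd q
  liftCmd (ifnz x p q) = ifnz (own x) (liftCmd p) (liftCmd q)
  liftCmd (while x p)  = while (own x) (liftCmd p)

  -- cur := t + 3 * hash, where (a , s , t) is the triple of words at cur.
  probeCmd : Cmd (9 + k)
  probeCmd =
    instr (readData acc cur) ⨾
    instr (apply acc mul acc chr) ⨾
    instr (apply cur add cur one) ⨾
    instr (readData tmp cur) ⨾
    instr (apply acc shr acc tmp) ⨾
    instr (apply acc mul acc three) ⨾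
    instr (apply cur add cur one) ⨾
    instr (readData cur cur) ⨾
    instr (apply cur add cur acc)

  -- Multiplying by the comparison bit replaces a branch: a different key yields 0, the null
  -- pointer.
  matchCmd : Cmd (9 + k)
  matchCmd =
    instr (readData acc cur) ⨾
    instr (apply cur add cur one) ⨾
    instr (readData cur cur) ⨾
    instr (apply acc eq acc chr) ⨾
    instr (apply cur mul acc cur)

  -- The product acts as a conjunction: it is nonzero exactly if letters remain and the current node
  -- exists.
  guardCmd : Cmd (9 + k)
  guardCmd =
    instr (apply guard lt pos len) ⨾
    instr (apply guard mul guard cur)

  descendCmd : Cmd (9 + k)
  descendCmd =
    instr (readPat chr pos) ⨾
    instr (apply pos add pos one) ⨾
    probeCmd ⨾ probeCmd ⨾ matchCmd ⨾ guardCmd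

  emitWordCmd : Cmd (9 + k)
  emitWordCmd =
    instr (readData tmp cur) ⨾
    instr (emit tmp) ⨾
    instr (apply cur add cur one) ⨾
    instr (apply acc sub acc one)

  answerCmd : Cmd (9 + k)
  answerCmd =
    -- The factor of the probes doubles as the offset of the answer's size in the node record.
    instr (apply cur add cur three) ⨾
    instr (readData acc cur) ⨾
    instr (apply cur add cur one) ⨾
    instr (readData cur cur) ⨾
    while acc emitWordCmd

  lookupCmd : Cmd (9 + k)
  lookupCmd =
    instr (const three 3) ⨾
    instr (patLen len) ⨾
    instr (readData cur one) ⨾
    guardCmd ⨾
    while guard descendCmd

  queryCmd : Cmd k → Cmd (9 + k)
  queryCmd q =
    instr (const one 1) ⨾
    -- Registers start at 0, so this reads word 0, the mode flag. Mode 0 ends the query with empty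
    -- output.
    instr (readData guard guard) ⨾
    ifnz guard (lookupCmd ⨾ ifnz cur answerCmd (liftCmd q)) skip

query : Program → Program
query (program k body) = program (9 + k) (queryCmd body)

-- Correctness and running time of the query program.

embed : ∀ {k} → Vec (Word b) 9 → State b k → State b (9 + k)
embed V (state R M O) = state (V Vec.++ R) M O

-- The interface between image and program. The clause over all `Y` makes the null pointer at a
-- missing node the pointer of the whole pattern as well, however many letters are still unread.
record Trie (mem : List (Word b)) (answer : String b → List (Word b)) (Light : String b → Set) : Set where
  field
    pointer : String b → Word b
    root    : At mem 1 (pointer [])
    node    : ∀ X → (Light X × (∀ Y → pointer (X ++ Y) ≡ wrap 0)) ⊎
                    (value (pointer X) ≢ 0 × NodeAt mem (pointer X) (answer X)
                        (λ c → pointer (X ∷ʳ c)))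

module Run {b k : ℕ} (D̂ : List (Word b)) (P : String b)
           (D̂≤ : length D̂ ≤ 2 ^ b) (P< : length P < 2 ^ b) (3< : 3 < 2 ^ b) where

  1< : 1 < 2 ^ b
  1< = ≤-trans (s≤s (s≤s z≤n)) 3<

  value-1 : value (wrap {b} 1) ≡ 1
  value-1 = value-wrap-< {b} 1<

  value-3 : value (wrap {b} 3) ≡ 3
  value-3 = value-wrap-< {b} 3<

  At-bound : ∀ {i x} → At D̂ i x → i < 2 ^ b
  At-bound a = ≤-trans (At⇒< a) D̂≤

  At-add : ∀ {x y : Word b} {m w} → value y ≡ m → At D̂ (value x + m) w →
      At D̂ (value (⟦ add ⟧ x y)) w
  At-add {x} {y} {w = w} refl a = subst (λ i → At D̂ i w) (sym (value-add x y (At-bound a))) a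

  read : ∀ {R : Vec (Word b) (9 + k)} {M O r x w} → At D̂ (value (Vec.lookup R x)) w →
         Exec D̂ P (instr (readData r x)) (state R M O) 1 (state (R Vec.[ r ]≔ w) M O)
  read {R} {M} {O} {r} {x} a with j , j≡ , refl ← At-index a = instr (readData j j≡)

  private
    w1 w3 : Word b
    w1 = wrap 1
    w3 = wrap 3

  match-value : ∀ {q c v} (e : Entry D̂ q c v) → ⟦ mul ⟧ (⟦ eq ⟧ (Entry.key e) c) (Entry.val e) ≡ v
  match-value {c = c} record { key = key ; val = val ; hit = hit ; miss = miss } with key ≟ c
  ... | yes refl  = trans (cong (λ x → ⟦ mul ⟧ x val) (eq-yes key)) (trans (mul-1ˡ 1< val) (hit refl))
  ... | no  key≢c = trans (cong (λ x → ⟦ mul ⟧ x val) (eq-no key c key≢c)) (trans (mul-0ˡ val) (sym (miss key≢c)))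

  module _ {M : Vec (Word b) (2 ^ b)} {R : Vec (Word b) k} where

    private
      St : Vec (Word b) 9 → List (Word b) → State b (9 + k)
      St V O = embed V (state R M O)

    probe-exec : ∀ {i l p c x y g a s t O} → Triple D̂ (value p) a s t →
      Exec D̂ P probeCmd (St (w1 ∷ i ∷ l ∷ p ∷ c ∷ x ∷ y ∷ w3 ∷ g ∷ []) O) 9
        (St (w1 ∷ i ∷ l ∷ ⟦ add ⟧ t (⟦ mul ⟧ (hash a s c) w3) ∷ c ∷ ⟦ mul ⟧
            (hash a s c) w3 ∷ s ∷ w3 ∷ g ∷ []) O)
    probe-exec {p = p} (triple at₁ at₂ at₃) =
      read at₁ ⨾ instr apply ⨾ instr apply ⨾ read (At-add value-1 at₂) ⨾ instr apply ⨾ instr apply ⨾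
          instr apply ⨾
      read (At-add value-1 (subst (λ m → At D̂ (m + 1) _) (sym (value-add p w1 bound)) at₃′)) ⨾
          instr apply
      where
      bound : value p + value w1 < 2 ^ b
      bound = subst (λ m → value p + m < 2 ^ b) (sym value-1) (At-bound at₂)
      at₃′ = subst (λ m → At D̂ (value p + m + 1) _) (sym value-1) at₃

    probe-value : ∀ {a s t c w} → At D̂ (probe a s t c) w →
        value (⟦ add ⟧ t (⟦ mul ⟧ (hash a s c) w3)) ≡ probe a s t c
    probe-value {a} {s} {t} {c} at =
        trans (value-add t h3 (subst (λ m → value t + m < 2 ^ b) (sym h3≡) (At-bound at)))
      (cong (value t +_) h3≡)
      where
      h3 : Word b
      h3 = ⟦ mul ⟧ (hash a s c) w3
      h3≡ : value h3 ≡ value (hash a s c) * 3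
      h3≡ = trans (value-mul (hash a s c) w3
          (subst (λ m → value (hash a s c) * m < 2 ^ b) (sym value-3)
              (≤-trans (s≤s (m≤n+m _ (value t))) (At-bound at))))
                  (cong (value (hash a s c) *_) value-3)

    match-exec : ∀ {i l p q c v x y g O} (e : Entry D̂ q c v) → value p ≡ q →
      Exec D̂ P matchCmd (St (w1 ∷ i ∷ l ∷ p ∷ c ∷ x ∷ y ∷ w3 ∷ g ∷ []) O) 5
        (St (w1 ∷ i ∷ l ∷ v ∷ c ∷ ⟦ eq ⟧ (Entry.key e) c ∷ y ∷ w3 ∷ g ∷ []) O)
    match-exec {i} {l} {c = c} {y = y} {g} {O} e refl = subst
      (λ v → Exec D̂ P matchCmd _ 5 (St
          (w1 ∷ i ∷ l ∷ v ∷ c ∷ ⟦ eq ⟧ (Entry.key e) c ∷ y ∷ w3 ∷ g ∷ []) O))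
      (match-value e)
      (read (Entry.key-at e) ⨾ instr apply ⨾ read (At-add value-1 (Entry.val-at e)) ⨾ instr apply ⨾
          instr apply)

    -- 27 is 2 for letter and position, 9 for each of the two probes, 5 for the comparison and 2 for
    -- the guard.
    descend-exec : ∀ {i l p c₀ c x y g a s t v O} → At P (value i) c → Triple D̂ (value p) a s t →
        Lookup D̂ a s t c v →
      ∃[ x′ ] ∃[ y′ ]
      Exec D̂ P descendCmd (St (w1 ∷ i ∷ l ∷ p ∷ c₀ ∷ x ∷ y ∷ w3 ∷ g ∷ []) O) 27
        (St (w1 ∷ ⟦ add ⟧ i w1 ∷ l ∷ v ∷ c ∷ x′ ∷ y′ ∷ w3 ∷ ⟦ mul ⟧
            (⟦ lt ⟧ (⟦ add ⟧ i w1) l) v ∷ []) O)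
    descend-exec {c = c} {a = a} {s} {t} at header
      record { a₂ = a₂ ; s₂ = s₂ ; t₂ = t₂ ; header = header₂ ; entry =
          e } with j , j≡ , refl ← At-index at =
      _ , _ , (instr (readPat j j≡) ⨾ instr apply ⨾ probe-exec header ⨾
        probe-exec (subst (λ q → Triple D̂ q a₂ s₂ t₂)
            (sym (probe-value {a} {s} {t} {c} (Triple.first header₂))) header₂) ⨾
        match-exec e (probe-value {a₂} {s₂} {t₂} {c} (Entry.key-at e)) ⨾ instr apply ⨾ instr apply)

    module Walk {answer : String b → List (Word b)} {Light} (trie : Trie D̂ answer Light) where
      open Trie trie

      guardOf : String b → Word b
      guardOf X = ⟦ mul ⟧ (⟦ lt ⟧ (wrap (length X)) (wrap (length P))) (pointer X)

      private
        at : String b → Word b → Word b → Word b → List (Word b) → State b (9 + k)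
        at X c x y = St (w1 ∷ wrap (length X) ∷ wrap
            (length P) ∷ pointer X ∷ c ∷ x ∷ y ∷ w3 ∷ guardOf X ∷ [])

      value-length : ∀ X Y → P ≡ X ++ Y → value (wrap {b} (length X)) ≡ length X
      value-length X Y refl = value-wrap-< {b}
          (≤-<-trans (subst (length X ≤_) (sym (length-++ X)) (m≤m+n _ _)) P<)

      -- Induction on the unread part `Y`. The loop stops because no node exists for `X`, and then
      -- none exists for `P`, or because `X` is `P`; either way `cur` holds `pointer P`. A round
      -- costs 27 and one test.
      walk : ∀ X Y → P ≡ X ++ Y → ∀ c x y O →
        ∃[ i ] ∃[ c′ ] ∃[ x′ ] ∃[ y′ ] ∃[ g ] ∃[ t ]
        Exec D̂ P (while guard descendCmd) (at X c x y O) t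
          (St (w1 ∷ i ∷ wrap (length P) ∷ pointer P ∷ c′ ∷ x′ ∷ y′ ∷ w3 ∷ g ∷ []) O)
        × t ≤ 28 * length Y + 1
      walk X Y P≡ c x y O with node X
      walk X Y P≡ c x y O | inj₁ (_ , absent) =
        wrap (length X) , c , x , y , guardOf X , 1 ,
        subst (λ p → Exec D̂ P (while guard descendCmd) (at X c x y O) 1
                       (St (w1 ∷ wrap (length X) ∷ wrap
                           (length P) ∷ p ∷ c ∷ x ∷ y ∷ w3 ∷ guardOf X ∷ []) O))
          (trans pX≡0 (trans (sym (absent Y)) (cong pointer (sym P≡))))
          (whilez (trans (cong value (trans (cong (⟦ mul ⟧ inRange) pX≡0) (mul-0ʳ inRange)))
              (value-0 {b})))
        , m≤n+m 1 _
        where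
        inRange : Word b
        inRange = ⟦ lt ⟧ (wrap (length X)) (wrap (length P))
        pX≡0 : pointer X ≡ wrap 0
        pX≡0 = trans (cong pointer (sym (++-identityʳ X))) (absent [])
      walk X [] P≡ c x y O | inj₂ _ =
        wrap (length X) , c , x , y , guardOf X , 1 ,
        subst (λ Z → Exec D̂ P (while guard descendCmd) (at X c x y O) 1
                       (St (w1 ∷ wrap (length X) ∷ wrap
                           (length P) ∷ pointer Z ∷ c ∷ x ∷ y ∷ w3 ∷ guardOf X ∷ []) O))
          (sym X≡P)
          (whilez (trans (cong (λ w → value (⟦ mul ⟧ w (pointer X)))
              (lt-no (wrap (length X)) (wrap (length P))
            (λ lt′ → <-irrefl (cong (λ Z → value (wrap {b} (length Z))) (sym X≡P)) lt′)))
            (trans (cong value (mul-0ˡ (pointer X))) (value-0 {b}))))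
        , ≤-refl
        where
        X≡P : P ≡ X
        X≡P = trans P≡ (++-identityʳ X)
      walk X (d ∷ Y) P≡ c x y O | inj₂
          (p≢0 , n) with descend-exec {i = wrap (length X)} {l = wrap (length P)} {p =
              pointer X} {c₀ = c} {x = x} {y = y} {g = guardOf X} {O = O}
           (subst₂ (λ Z i → At Z i d) (sym P≡)
               (trans (+-identityʳ (length X)) (sym (value-length X (d ∷ Y) P≡))) (At-++ʳ X here))
                   (NodeAt.header n) (NodeAt.lookups n d)
           | walk (X ∷ʳ d) Y (trans P≡ (sym (++-assoc X [ d ] Y))) d
      ... | x₁ , y₁ , step | rest with rest x₁ y₁ O
      ... | i , c′ , x′ , y′ , g , t , run , t≤ =
        i , c′ , x′ , y′ , g , suc (27 + t) ,
        whilenz guard≢0 (subst (λ w → Exec D̂ P descendCmd _ 27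
            (St (w1 ∷ w ∷ wrap (length P) ∷ pointer (X ∷ʳ d) ∷ d ∷ x₁ ∷ y₁ ∷ w3
                                          ∷ ⟦ mul ⟧ (⟦ lt ⟧ w (wrap (length P)))
                                              (pointer (X ∷ʳ d)) ∷ []) O)) next step) run
        , ≤-trans (+-monoʳ-≤ 28 t≤) (≤-reflexive
            (trans (sym (+-assoc 28 (28 * length Y) 1)) (cong (_+ 1) (sym (*-suc 28 (length Y))))))
        where
        |X|<|P| : length X < length P
        |X|<|P| = subst (length X <_) (trans (sym (length-++ X)) (cong length (sym P≡)))
            (m<m+n (length X) (s≤s z≤n))
        guard≢0 : value (guardOf X) ≢ 0
        guard≢0 = subst (λ w → value w ≢ 0) (sym (trans (cong (λ w → ⟦ mul ⟧ w (pointer X))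
          (lt-yes (wrap (length X)) (wrap (length P))
              (subst₂ _<_ (sym (value-length X (d ∷ Y) P≡)) (sym (value-wrap-< {b} P<)) |X|<|P|)))
          (mul-1ˡ 1< (pointer X)))) p≢0
        next : ⟦ add ⟧ (wrap (length X)) w1 ≡ wrap (length (X ∷ʳ d))
        next = cong wrap (trans (cong₂ _+_ (value-length X (d ∷ Y) P≡) value-1) (sym (length-++ X)))

    sub-1 : ∀ {x m} → value x ≡ suc m → value (⟦ sub ⟧ x w1) ≡ m
    sub-1 {x} {m} x≡ = begin
      value (wrap {b} (value x + (2 ^ b ∸ value w1)))
        ≡⟨ cong₂ (λ u v → value (wrap {b} (u + (2 ^ b ∸ v)))) x≡ value-1 ⟩
      value (wrap {b} (suc m + (2 ^ b ∸ 1)))           ≡⟨ value-wrap b (suc m + (2 ^ b ∸ 1)) ⟩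
      (suc m + (2 ^ b ∸ 1)) %2^ b
        ≡⟨ cong (_%2^ b) (trans (sym (+-suc m _)) (cong (m +_) (m+[n∸m]≡n (m^n>0 2 b)))) ⟩
      (m + 2 ^ b) %2^ b                                ≡⟨ [m+n]%n≡m%n m (2 ^ b) {{2^≢0 b}} ⟩
      m %2^ b
        ≡⟨ m<n⇒m%n≡m {{2^≢0 b}} (<-trans (n<1+n m) (subst (_< 2 ^ b) x≡ (value<2^ x))) ⟩
      m                                                ∎
      where open ≡-Reasoning

    emit-exec : ∀ ws {i l p c x y g O} → value x ≡ length ws → Holds D̂ (value p) ws →
      ∃[ s ] Exec D̂ P (while acc emitWordCmd) (St (w1 ∷ i ∷ l ∷ p ∷ c ∷ x ∷ y ∷ w3 ∷ g ∷ []) O)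
          (5 * length ws + 1) s
           × State.out s ≡ O ++ ws
    emit-exec [] {O = O} x≡ h = _ , whilez x≡ , sym (++-identityʳ O)
    emit-exec (w ∷ ws) {i} {l} {p} {c} {x} {y} {g} {O} x≡ h
      with emit-exec ws {i} {l} {⟦ add ⟧ p w1} {c} {⟦ sub ⟧ x w1} {w} {g} {O ++ [ w ]} (sub-1 {x} x≡) tail-at
      where
      tail-at : Holds D̂ (value (⟦ add ⟧ p w1)) ws
      tail-at {i} {z} a = subst (λ m → At D̂ m z)
        (trans (sym (+-assoc (value p) 1 i))
            (cong (_+ i) (sym (trans (value-add p w1 bound) (cong (value p +_) value-1)))))
                (h (there a))
        where
        bound : value p + value w1 < 2 ^ b
        bound = subst (λ m → value p + m < 2 ^ b) (sym value-1)
          (≤-<-trans (+-monoʳ-≤ (value p) (s≤s z≤n)) (At-bound (h (there a))))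
    ... | s , run , out≡ = s
      , subst (λ t → Exec D̂ P (while acc emitWordCmd)
          (St (w1 ∷ i ∷ l ∷ p ∷ c ∷ x ∷ y ∷ w3 ∷ g ∷ []) O) t s)
          (trans (sym (+-assoc 5 (5 * length ws) 1)) (cong (_+ 1) (sym (*-suc 5 (length ws)))))
          (whilenz (λ x≡0 → 0≢1+n (trans (sym x≡0) x≡))
            (read (subst (λ i → At D̂ i w) (+-identityʳ (value p)) (h here)) ⨾ instr emit ⨾
                instr apply ⨾ instr apply) run)
      , trans out≡ (++-assoc O [ w ] ws)

    answer-exec : ∀ {i l p c x y g child ws} → NodeAt D̂ p ws child →
      ∃[ s ] Exec D̂ P answerCmd (St (w1 ∷ i ∷ l ∷ p ∷ c ∷ x ∷ y ∷ w3 ∷ g ∷ []) [])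
          (4 + (5 * length ws + 1)) s
           × State.out s ≡ ws
    answer-exec {p = p} {ws = ws} n with emit-exec ws (NodeAt.size≡ n) (NodeAt.ans-at n)
    ... | s , run , out≡ = s , (instr apply ⨾ read (At-add value-3 (NodeAt.size-at n)) ⨾ instr apply ⨾
        read (At-add value-1 (subst (λ m → At D̂ (m + 1) (NodeAt.start n))
            (sym (trans (value-add p w3 bound) (cong (value p +_) value-3))) (NodeAt.start-at n))) ⨾
                run)
        , out≡
      where
      bound : value p + value w3 < 2 ^ b
      bound = subst (λ m → value p + m < 2 ^ b) (sym value-3) (At-bound (NodeAt.size-at n))

-- Simulation of the given algorithm.

module Lift {b k : ℕ} {D D̂ : List (Word b)} {P : String b}
            (D̂≤ : length D̂ ≤ 2 ^ b) (P< : length P < 2 ^ b) (3< : 3 < 2 ^ b)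
            (D-at : ∀ {i x} → At D i x → At D̂ (2 + i) x) where

  open Run {b} {k} D̂ P D̂≤ P< 3<

  -- Only `readData` costs more than one unit, for shifting its address by 2. The shifted address
  -- does not overflow because its cell is occupied in `D̂`.
  lift-step : ∀ {i : Instr k} {s s′} → Step D P i s s′ → ∀ V →
              ∃[ V′ ] ∃[ t ] Exec D̂ P (liftInstr i) (embed V s) t (embed V′ s′) × t ≤ 3
  lift-step step V@(_ ∷ _ ∷ _ ∷ _ ∷ _ ∷ _ ∷ _ ∷ _ ∷ _ ∷ []) with step
  ... | const         = V , 1 , instr const , s≤s z≤n
  ... | apply         = V , 1 , instr apply , s≤s z≤n
  ... | patLen        = V , 1 , instr patLen , s≤s z≤n
  ... | readPat i i≡  = V , 1 , instr (readPat i i≡) , s≤s z≤n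
  ... | readWork      = V , 1 , instr readWork , s≤s z≤n
  ... | writeWork     = V , 1 , instr writeWork , s≤s z≤n
  ... | emit          = V , 1 , instr emit , s≤s z≤n
  ... | readData {R = R} {x = x} i i≡ = _ ∷ _ ∷ _ ∷ _ ∷ _ ∷ _ ∷ _ ∷ _ ∷ _ ∷ [] , 3 ,
    (instr const ⨾ instr apply ⨾ read address) , ≤-refl
    where
    at-2 : At D̂ (value (wrap {b} 2) + value (Vec.lookup R x)) (lookup D i)
    at-2 = subst₂ (λ m n → At D̂ (m + n) (lookup D i))
        (sym (value-wrap-< {b} (<-trans (n<1+n 2) 3<))) i≡ (D-at (At-lookup D i))
    address : At D̂ (value (⟦ add ⟧ (wrap 2) (Vec.lookup R x))) (lookup D i)
    address = At-add {x = wrap 2} refl at-2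

  reg-own : ∀ V (s : State b k) x → reg (embed V s) (own x) ≡ reg s x
  reg-own (_ ∷ _ ∷ _ ∷ _ ∷ _ ∷ _ ∷ _ ∷ _ ∷ _ ∷ []) s x = refl

  lift-exec : ∀ {c : Cmd k} {s t s′} → Exec D P c s t s′ → ∀ V →
              ∃[ V′ ] ∃[ t′ ] Exec D̂ P (liftCmd c) (embed V s) t′ (embed V′ s′) × t′ ≤ 3 * t
  lift-exec skip V = V , 0 , skip , z≤n
  lift-exec (instr step) V = lift-step step V
  lift-exec (_⨾_ {t = t} {t′} p q) V
    with V₁ , t₁ , p′ , t₁≤ ← lift-exec p V
    with V₂ , t₂ , q′ , t₂≤ ← lift-exec q V₁ =
    V₂ , t₁ + t₂ , p′ ⨾ q′ , ≤-trans (+-mono-≤ t₁≤ t₂≤) (≤-reflexive (sym (*-distribˡ-+ 3 t t′)))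
  lift-exec (ifnz {x = x} {s = s} {t = t} x≢0 p) V
    with V₁ , t₁ , p′ , t₁≤ ← lift-exec p V =
    V₁ , suc t₁ , ifnz (subst (λ w → value w ≢ 0) (sym (reg-own V s x)) x≢0) p′ ,
    ≤-trans (s≤s t₁≤) (≤-trans (m≤n+m _ 2) (≤-reflexive (sym (*-suc 3 t))))
  lift-exec (ifz {x = x} {s = s} {t = t} x≡0 p) V
    with V₁ , t₁ , p′ , t₁≤ ← lift-exec p V =
    V₁ , suc t₁ , ifz (trans (cong value (reg-own V s x)) x≡0) p′ ,
    ≤-trans (s≤s t₁≤) (≤-trans (m≤n+m _ 2) (≤-reflexive (sym (*-suc 3 t))))
  lift-exec (whilenz {x = x} {s = s} {t = t} {t′} x≢0 p q) V
    with V₁ , t₁ , p′ , t₁≤ ← lift-exec p V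
    with V₂ , t₂ , q′ , t₂≤ ← lift-exec q V₁ =
    V₂ , suc (t₁ + t₂) , whilenz (subst (λ w → value w ≢ 0) (sym (reg-own V s x)) x≢0) p′ q′ ,
    ≤-trans (s≤s (≤-trans (+-mono-≤ t₁≤ t₂≤) (≤-reflexive (sym (*-distribˡ-+ 3 t t′)))))
            (≤-trans (m≤n+m _ 2) (≤-reflexive (sym (*-suc 3 (t + t′)))))
  lift-exec (whilez {x = x} {s = s} x≡0) V =
    V , 1 , whilez (trans (cong value (reg-own V s x)) x≡0) , s≤s z≤n

module Query {b k : ℕ} (body : Cmd k) {D D̂ : List (Word b)} {P : String b}
             (D̂≤ : length D̂ ≤ 2 ^ b) (P< : length P < 2 ^ b) (3< : 3 < 2 ^ b)
             (D-at : ∀ {i x} → At D i x → At D̂ (2 + i) x)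
             {answer : String b → List (Word b)} {Light} (trie : Trie D̂ answer Light)
                 (mode : At D̂ 0 (wrap 1)) where

  private
    Q : Program
    Q = program k body

    R₀ : Vec (Word b) k
    R₀ = Vec.replicate k (wrap 0)

    M₀ : Vec (Word b) (2 ^ b)
    M₀ = Vec.replicate (2 ^ b) (wrap 0)

  open Run {b} {k} D̂ P D̂≤ P< 3<
  open Lift {b} {k} {D} {D̂} {P} D̂≤ P< 3< D-at
  open Trie trie
  open Walk {M = M₀} {R = R₀} trie

  lookup-exec : ∀ g →
    ∃[ i ] ∃[ c ] ∃[ x ] ∃[ y ] ∃[ g′ ] ∃[ t ]
    Exec D̂ P lookupCmd
      (embed (wrap 1 ∷ wrap 0 ∷ wrap 0 ∷ wrap 0 ∷ wrap 0 ∷ wrap 0 ∷ wrap 0 ∷ wrap 0 ∷ g ∷ [])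
          (state R₀ M₀ [])) (5 + t)
      (embed (wrap 1 ∷ i ∷ wrap (length P) ∷ pointer P ∷ c ∷ x ∷ y ∷ wrap 3 ∷ g′ ∷ [])
          (state R₀ M₀ []))
    × t ≤ 28 * length P + 1
  lookup-exec g with i , c , x , y , g′ , t , run , t≤ ← walk [] P refl (wrap 0) (wrap 0)
      (wrap 0) [] =
    i , c , x , y , g′ , t ,
    (instr const ⨾ instr patLen ⨾ read (subst (λ i → At D̂ i (pointer [])) (sym value-1) root) ⨾
        (instr apply ⨾ instr apply) ⨾ run) , t≤

  private
    mode-exec : ∀ {t s c} →
      Exec D̂ P c (embed (wrap 1 ∷ wrap 0 ∷ wrap 0 ∷ wrap 0 ∷ wrap 0 ∷ wrap 0 ∷ wrap 0 ∷ wrap 0 ∷ wrap 1 ∷ []) (state R₀ M₀ [])) t s →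
      Exec D̂ P (instr (const one 1) ⨾ instr (readData guard guard) ⨾ ifnz guard c skip) initial
          (3 + t) s
    mode-exec run = instr const ⨾ read (subst (λ i → At D̂ i (wrap 1)) (sym (value-0 {b})) mode) ⨾
      ifnz (λ 1≡0 → 1+n≢0 (trans (sym value-1) 1≡0)) run

  stored : value (pointer P) ≢ 0 → ∀ {child} → NodeAt D̂ (pointer P) (answer P) child →
           ∃[ t ] Returns (query Q) D̂ P (answer P) t × t ≤ 15 +
               (28 * length P + 5 * length (answer P))
  stored p≢0 n
    with i , c , x , y , g′ , t , run , t≤ ← lookup-exec (wrap 1)
    with s , emitted , out≡ ← answer-exec {M = M₀} {R = R₀} {i = i} {l = wrap (length P)} {c = c} {x = x} {y = y} {g = g′} n =
    _ , (s , mode-exec (run ⨾ ifnz p≢0 emitted) , out≡)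
    , ≤-trans (s≤s (s≤s (s≤s (+-monoˡ-≤ (1 + (4 + (5 * length (answer P) + 1))) (+-monoʳ-≤ 5 t≤)))))
        (≤-reflexive (lemma (length P) (length (answer P))))
    where
    lemma : ∀ m w → 3 + (5 + (28 * m + 1) + (1 + (4 + (5 * w + 1)))) ≡ 15 + (28 * m + 5 * w)
    lemma = solve-∀

  -- The descent writes neither to the registers of `Q` nor to working memory nor to the output, so
  -- the simulated algorithm starts from its own initial state.
  delegated : value (pointer P) ≡ 0 → ∀ {A t} → Returns Q D P A t →
              ∃[ t′ ] Returns (query Q) D̂ P A t′ × t′ ≤ 10 + (28 * length P + 3 * t)
  delegated p≡0 {t = t} (s , exec , out≡)
    with i , c , x , y , g′ , t₁ , run , t₁≤ ← lookup-exec (wrap 1)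
    with V , t₂ , lifted , t₂≤ ← lift-exec exec (wrap 1 ∷ i ∷ wrap (length P) ∷ pointer P ∷ c ∷ x ∷ y ∷ wrap 3 ∷ g′ ∷ []) =
    _ , (embed V s , mode-exec (run ⨾ ifz p≡0 lifted) , out≡)
    , ≤-trans (s≤s (s≤s (s≤s (+-mono-≤ (+-monoʳ-≤ 5 t₁≤) (s≤s t₂≤)))))
        (≤-reflexive (lemma (length P) t))
    where
    lemma : ∀ m t → 3 + (5 + (28 * m + 1) + (1 + 3 * t)) ≡ 10 + (28 * m + 3 * t)
    lemma = solve-∀

  respond : ∀ {t} → Returns Q D P (answer P) t → ∃[ t′ ] Returns (query Q) D̂ P (answer P) t′ ×
            (t′ ≤ 15 + (28 * length P + 5 * length (answer P)) ⊎
                (Light P × t′ ≤ 10 + (28 * length P + 3 * t)))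
  respond ret with node P
  ... | inj₂ (p≢0 , n) = let t′ , ret′ , t′≤ = stored p≢0 n in t′ , ret′ , inj₁ t′≤
  ... | inj₁ (light , absent) =
    let t′ , ret′ , t′≤ = delegated (trans (cong value p≡0) (value-0 {b})) ret in t′ , ret′ , inj₂ (light , t′≤)
    where
    p≡0 : pointer P ≡ wrap 0
    p≡0 = trans (cong pointer (sym (++-identityʳ P))) (absent [])

-- With W = 0 all answers are empty, and there is no room even for a trie.
empty-answers : ∀ {b} (Q : Program) (P : String b) →
                Returns (query Q) [ wrap 0 ] P [] 3
empty-answers {b} (program k body) P =
  _ , (instr const ⨾ instr (readData zero (sym (value-0 {b}))) ⨾ ifz (value-0 {b}) skip) , refl

-- Assembly and constants.

module _ {b : ℕ} (T : String (suc b)) (D : List (Word (suc b)))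
         (answer : String (suc b) → List (Word (suc b)))
             (T-fits : 12 * length T + 1 ≤ 2 ^ suc b) where

  open Heavy T
  open Image T D answer T-fits

  trie : length image ≤ 2 ^ suc b → Trie image answer (λ X → length (Occ T X) ≤ length X)
  trie image≤ = record { pointer = pointer ; root = there here ; node = λ X →
      status X (nodeOf X) refl }
    where
    status : ∀ X m → nodeOf X ≡ m →
        (length (Occ T X) ≤ length X × (∀ Y → pointer (X ++ Y) ≡ wrap 0)) ⊎
             (value (pointer X) ≢ 0 × NodeAt image (pointer X) (answer X) (λ c → pointer (X ∷ʳ c)))
    status X nothing  X≡ = inj₁ (≮⇒≥ (nodeOf-nothing X≡) , λ Y →
        pointer-nothing (nodeOf-⊑ (⊑-refl X ++ᵖ Y) X≡))
    status X (just i) X≡ = inj₂ (pointer≢0 image≤ X≡ , node-at image≤ X≡)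

-- For a light pattern the occurrences are absorbed by `length P`, at most doubling the given time,
-- and the simulation triples it: hence `6 * c`. The 100 covers 28 units per letter, 5 per stored
-- word and the fixed overhead.
answers-trie : ∀ {b k} (body : Cmd k)
    (T : String b) {D D̂ : List (Word b)} {answer} {w : String b → ℕ} {c} →
  length D̂ ≤ 2 ^ b → length T < 2 ^ b → 3 < 2 ^ b → (∀ {i x} → At D i x → At D̂ (2 + i) x) →
  Trie D̂ answer (λ X → length (Occ T X) ≤ length X) → At D̂ 0 (wrap 1) →
  (∀ P → length P ≤ length T → length (answer P) ≤ w P) →
  Answers (program k body) D (length T) answer (λ P → c * (1 + length P + length (Occ T P) + w P)) →
  Answers (query (program k body)) D̂ (length T) answer (λ P → (100 + 6 * c) * (1 + length P + w P))
answers-trie {k = k} body T {D} {D̂} {answer} {w} {c} D̂≤ T< 3< D-at trie mode sizes correct P P≤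
  with t , ret , t≤ ← correct P P≤
  with t′ , ret′ , bound ← Query.respond body {D} {D̂} {P} D̂≤ (≤-<-trans P≤ T<) 3< D-at trie mode ret =
  t′ , ret′ , [ (λ t′≤ → ≤-trans t′≤ stored≤) ,
      (λ (light , t′≤) → ≤-trans t′≤ (delegated≤ light t≤)) ]′ bound
  where
  open ≤-Reasoning
  m = length P
  o = length (Occ T P)
  stored≤ : 15 + (28 * m + 5 * length (answer P)) ≤ (100 + 6 * c) * (1 + m + w P)
  stored≤ = begin
    15 + (28 * m + 5 * length (answer P))
      ≤⟨ +-monoʳ-≤ 15 (+-monoʳ-≤ (28 * m) (*-monoʳ-≤ 5 (sizes P P≤))) ⟩
    15 + (28 * m + 5 * w P)                    ≤⟨ m≤m+n _ (85 + 72 * m + 95 * w P) ⟩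
    15 + (28 * m + 5 * w P) + (85 + 72 * m + 95 * w P) ≡⟨ lemma m (w P) ⟩
    100 * (1 + m + w P)                        ≤⟨ *-monoˡ-≤ (1 + m + w P) (m≤m+n 100 (6 * c)) ⟩
    (100 + 6 * c) * (1 + m + w P)                          ∎
    where
    lemma : ∀ m v → 15 + (28 * m + 5 * v) + (85 + 72 * m + 95 * v) ≡ 100 * (1 + m + v)
    lemma = solve-∀
  delegated≤ : ∀ {t} → o ≤ m → t ≤ c * (1 + m + o + w P) →
      10 + (28 * m + 3 * t) ≤ (100 + 6 * c) * (1 + m + w P)
  delegated≤ {t} o≤m t≤ = begin
    10 + (28 * m + 3 * t)
      ≤⟨ +-monoʳ-≤ 10 (+-monoʳ-≤ (28 * m)
           (*-monoʳ-≤ 3 (≤-trans t≤ (*-monoʳ-≤ c (+-monoˡ-≤ (w P) (+-monoʳ-≤ (1 + m) o≤m)))))) ⟩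
    10 + (28 * m + 3 * (c * (1 + m + m + w P)))
      ≤⟨ m≤m+n _ (90 + 72 * m + 100 * w P + 3 * (c * (1 + w P))) ⟩
    10 + (28 * m + 3 * (c * (1 + m + m + w P))) + (90 + 72 * m + 100 * w P + 3 * (c * (1 + w P)))
      ≡⟨ lemma m c (w P) ⟩
    (100 + 6 * c) * (1 + m + w P) ∎
    where
    lemma : ∀ m c v → 10 + (28 * m + 3 * (c * (1 + m + m + v))) +
        (90 + 72 * m + 100 * v + 3 * (c * (1 + v)))
                    ≡ (100 + 6 * c) * (1 + m + v)
    lemma = solve-∀

theorem1p2 : ∀ (Q : Program) (c : ℕ) →
    ∃[ Q̂ ] ∃[ ĉ ]
    ∀ (b : ℕ) (T : String b) (D : List (Word b))
    (answer : String b → List (Word b)) (w : String b → ℕ) (W : ℕ) →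
    (∀ P → length P ≤ length T → length (answer P) ≤ w P × w P ≤ W) →
    Answers Q D (length T) answer
    (λ P → c * (1 + length P + length (Occ T P) + w P)) →
    ĉ * (1 + length T + length D + W * length T) ≤ 2 ^ b →
    ∃[ D̂ ]
    length D̂ ≤ ĉ * (1 + length D + W * length T) ×
    Answers Q̂ D̂ (length T) answer
    (λ P → ĉ * (1 + length P + w P))
theorem1p2 Q@(program k body) c = query Q , 100 + 6 * c , construct
  where
  ĉ : ℕ
  ĉ = 100 + 6 * c

  100≤ĉ : ∀ m → 100 * m ≤ ĉ * m
  100≤ĉ m = *-monoˡ-≤ m (m≤m+n 100 (6 * c))

  construct : ∀ (b : ℕ) (T : String b) (D : List (Word b))
    (answer : String b → List (Word b)) (w : String b → ℕ) (W : ℕ) →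
    (∀ P → length P ≤ length T → length (answer P) ≤ w P × w P ≤ W) →
    Answers Q D (length T) answer
    (λ P → c * (1 + length P + length (Occ T P) + w P)) →
    ĉ * (1 + length T + length D + W * length T) ≤ 2 ^ b →
    ∃[ D̂ ]
    length D̂ ≤ ĉ * (1 + length D + W * length T) ×
    Answers (query Q) D̂ (length T) answer
    (λ P → ĉ * (1 + length P + w P))
  -- With zero-bit words memory would have one cell, against a demand of at least 100. From here on
  -- the word size is a successor, as the count of odd multipliers requires.
  construct zero T D answer w W sizes correct fits =
    contradiction (≤-trans (≤-trans (m≤m*n 100 (1 + length T + length D + W * length T))
        (100≤ĉ (1 + length T + length D + W * length T))) fits)
      λ { (s≤s ()) }
  construct (suc b) T D answer w zero sizes correct fits =
    [ wrap 0 ] , *-mono-≤ (m≤m+n 1 (99 + 6 * c)) (s≤s z≤n) , answers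
    where
    answers : Answers (query Q) [ wrap 0 ] (length T) answer (λ P → ĉ * (1 + length P + w P))
    answers P P≤ = 3 , subst (λ A → Returns (query Q) [ wrap 0 ] P A 3)
        (sym (empty (answer P) (n≤0⇒n≡0 (≤-trans (proj₁ (sizes P P≤)) (proj₂ (sizes P P≤))))))
                         (empty-answers Q P)
                     , *-mono-≤ (m≤m+n 3 (97 + 6 * c)) (s≤s (z≤n {length P + w P}))
      where
      empty : ∀ (ws : List (Word (suc b))) → length ws ≡ 0 → ws ≡ []
      empty [] _ = refl
  construct (suc b) T D answer w W@(suc W′) sizes correct fits =
    image , ≤-trans image≤100 (100≤ĉ (1 + length D + W * length T)) , respond
    where
    n = length T
    d = length D
    X = 1 + n + d + W * n
    open ≤-Reasoning

    100X≤ : 100 * X ≤ 2 ^ suc b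
    100X≤ = ≤-trans (100≤ĉ X) fits

    T-fits : 12 * n + 1 ≤ 2 ^ suc b
    T-fits = begin
      12 * n + 1     ≤⟨ +-mono-≤ (*-monoˡ-≤ n (m≤m+n 12 88)) (s≤s z≤n) ⟩
      100 * n + 100  ≡⟨ trans (+-comm (100 * n) 100) (sym (*-suc 100 n)) ⟩
      100 * suc n    ≤⟨ *-monoʳ-≤ 100 (≤-trans (m≤m+n (suc n) d) (m≤m+n (suc n + d) (W * n))) ⟩
      100 * X        ≤⟨ 100X≤ ⟩
      2 ^ suc b      ∎

    3< : 3 < 2 ^ suc b
    3< = ≤-trans (≤-trans (m≤m+n 4 96) (m≤m*n 100 X)) 100X≤

    T< : n < 2 ^ suc b
    T< = ≤-trans (≤-trans (≤-reflexive (+-comm 1 n)) (+-monoˡ-≤ 1 (m≤n*m n 12))) T-fits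

    open Image T D answer T-fits using (image; length-image; D-at)

    image≤100 : length image ≤ 100 * (1 + d + W * n)
    image≤100 = begin
      length image
        ≤⟨ length-image W (λ P P≤ → ≤-trans (proj₁ (sizes P P≤)) (proj₂ (sizes P P≤))) ⟩
      2 + d + (59 * n + W * n)
        -- Since `W` is at least 1, the 59 words per position are absorbed by `W * n`.
        ≤⟨ +-monoʳ-≤ (2 + d) (+-monoˡ-≤ (W * n) (*-monoʳ-≤ 59 (m≤n*m n W))) ⟩
      2 + d + (59 * (W * n) + W * n)    ≤⟨ m≤m+n _ (98 + 99 * d + 40 * (W * n)) ⟩
      2 + d + (59 * (W * n) + W * n) + (98 + 99 * d + 40 * (W * n)) ≡⟨ lemma d (W * n) ⟩
      100 * (1 + d + W * n)             ∎
      where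
      lemma : ∀ d v → 2 + d + (59 * v + v) + (98 + 99 * d + 40 * v) ≡ 100 * (1 + d + v)
      lemma = solve-∀

    image≤ : length image ≤ 2 ^ suc b
    image≤ = ≤-trans image≤100 (≤-trans (*-monoʳ-≤ 100 (+-monoˡ-≤ (W * n) (s≤s (m≤n+m d n)))) 100X≤)

    respond : Answers (query Q) image n answer (λ P → ĉ * (1 + length P + w P))
    respond = answers-trie body T {w = w} {c = c} image≤ T< 3< D-at
        (trie T D answer T-fits image≤) here
      (λ P P≤ → proj₁ (sizes P P≤)) correct
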